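{- Let $n$ be a positive integer. Every semiuniform linear subdivision of $\Delta_n$ contains at least $n-3$ parallelograms if $n$ is divisible by $3$, and at least $n-1$ parallelograms otherwise. Moreover, this bound is sharp: for every positive integer $n$ there is a semiuniform linear subdivision of $\Delta_n$ with exactly $n-3$ parallelograms if $3\mid n$ and exactly $n-1$ parallelograms otherwise.
   Context: $\Delta_n=\{(x,y):x\ge0,\ y\ge0,\ x+y\le n\}$. Let $T=\mathrm{conv}\{(0,0),(1,0),(0,1)\}$, $\bar e_1=(-1,1)$, $\bar e_2=(0,-1)$, $\bar e_3=(1,0)$, and for nonnegative integers $c,w_1,w_2,w_3$ let $P_{c,w_1,w_2,w_3}$ be the Minkowski sum of $c$ copies of $T$ and $w_i$ copies of the segment $[0,\bar e_i]$ ($i=1,2,3$). A semiuniform linear subdivision of $\Delta_n$ is a polyhedral subdivision of $\Delta_n$ all of whose cells are lattice translates of polygons of the form $P_{c,0,0,0}$ or $P_{0,w_1,w_2,w_3}$ with $c,w_1,w_2,w_3\in\{0,1\}$; its two-dimensional cells are thus translates of $T$ (triangles), Minkowski sums of two of the segments $[0,\bar e_i]$ (parallelograms), or the Minkowski sum of all three (hexagons). -}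

module Defs where

open import Data.Nat using (ℕ; zero; suc)
import Data.Nat as ℕ
open import Data.Integer using (ℤ; +_)
open import Data.Rational using (ℚ; _/_; 0ℚ; _+_; _-_; _≤_; _<_; ∣_∣)
open import Data.Product using (_×_; _,_; Σ; ∃; proj₁; proj₂)
open import Data.List using (List; []; _∷_)
open import Data.List.Relation.Unary.All using (All)
open import Data.List.Relation.Unary.Any using (Any)
open import Data.List.Relation.Unary.AllPairs using (AllPairs)
open import Relation.Binary.PropositionalEquality using (_≡_)
open import Relation.Nullary using (¬_)

Point : Set
Point = ℚ × ℚ

ℕ→ℚ : ℕ → ℚ
ℕ→ℚ n = + n / 1

ℤ→ℚ : ℤ → ℚ
ℤ→ℚ z = z / 1

_∈Δ_ : Point → ℕ → Set
(x , y) ∈Δ n = (0ℚ ≤ x) × (0ℚ ≤ y) × (x + y ≤ ℕ→ℚ n)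

-- Membership in P_{c,w1,w2,w3} = c·T + w1[0,ē1] + w2[0,ē2] + w3[0,ē3],
-- with T = conv{(0,0),(1,0),(0,1)}, ē1 = (-1,1), ē2 = (0,-1), ē3 = (1,0).
-- (The Minkowski sum of c copies of the convex set T is c·T = {(a,b) : a,b ≥ 0, a+b ≤ c};
--  the sum of w copies of [0,ē] is [0, w ē].)
InP : ℕ → ℕ → ℕ → ℕ → Point → Set
InP c w₁ w₂ w₃ (x , y) =
  Σ ℚ λ a → Σ ℚ λ b → Σ ℚ λ l₁ → Σ ℚ λ l₂ → Σ ℚ λ l₃ →
    (0ℚ ≤ a) × (0ℚ ≤ b) × (a + b ≤ ℕ→ℚ c)
    × (0ℚ ≤ l₁) × (l₁ ≤ ℕ→ℚ w₁)
    × (0ℚ ≤ l₂) × (l₂ ≤ ℕ→ℚ w₂)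
    × (0ℚ ≤ l₃) × (l₃ ≤ ℕ→ℚ w₃)
    × (x ≡ (a - l₁) + l₃) × (y ≡ (b + l₁) - l₂)

-- The five shapes of two-dimensional cells of a semiuniform linear subdivision:
-- P_{1,0,0,0} (triangle), P_{0,1,1,0}, P_{0,1,0,1}, P_{0,0,1,1} (parallelograms),
-- P_{0,1,1,1} (hexagon).
data Shape : Set where
  tri par₁₂ par₁₃ par₂₃ hex : Shape

c-of w₁-of w₂-of w₃-of : Shape → ℕ
c-of tri = 1
c-of _   = 0
w₁-of tri   = 0
w₁-of par₁₂ = 1
w₁-of par₁₃ = 1
w₁-of par₂₃ = 0
w₁-of hex   = 1
w₂-of tri   = 0
w₂-of par₁₂ = 1
w₂-of par₁₃ = 0
w₂-of par₂₃ = 1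
w₂-of hex   = 1
w₃-of tri   = 0
w₃-of par₁₂ = 0
w₃-of par₁₃ = 1
w₃-of par₂₃ = 1
w₃-of hex   = 1

record Cell : Set where
  constructor cell
  field
    shape : Shape
    u v   : ℤ
open Cell public

_∈C_ : Point → Cell → Set
(x , y) ∈C C = InP (c-of (shape C)) (w₁-of (shape C)) (w₂-of (shape C)) (w₃-of (shape C))
                   (x - ℤ→ℚ (u C) , y - ℤ→ℚ (v C))

InteriorOf : Cell → Point → Set
InteriorOf C (x , y) =
  Σ ℚ λ ε → (0ℚ < ε) × (∀ (q : Point) → ∣ proj₁ q - x ∣ < ε → ∣ proj₂ q - y ∣ < ε → q ∈C C)

-- A semiuniform linear subdivision of Δ_n, given by the list of its
-- two-dimensional cells: every cell lies in Δ_n, the cells cover Δ_n, and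
-- distinct cells (distinct list positions) have disjoint interiors.
-- (Face-to-faceness is automatic for such cells.)
record IsSemiuniformSubdivision (n : ℕ) (cells : List Cell) : Set where
  field
    inside   : All (λ C → ∀ (p : Point) → p ∈C C → p ∈Δ n) cells
    covers   : ∀ (p : Point) → p ∈Δ n → Any (λ C → p ∈C C) cells
    disjoint : AllPairs (λ C D → ∀ (p : Point) → ¬ (InteriorOf C p × InteriorOf D p)) cells

isPar? : Shape → ℕ
isPar? par₁₂ = 1
isPar? par₁₃ = 1
isPar? par₂₃ = 1
isPar? _     = 0

#parallelograms : List Cell → ℕ
#parallelograms []       = 0
#parallelograms (C ∷ Cs) = isPar? (shape C) ℕ.+ #parallelograms Cs

{-# OPTIONS --safe #-}

-- All cells are unions of triangles of the unit triangular lattice, so a subdivision is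
-- a partition of the up- and down-triangles in Δ.  Lower bound: at an interior lattice
-- point three up- and three down-triangles meet.  A hexagon contributes equally many of
-- both kinds at each lattice point, a parallelogram has a surplus down-triangle at just
-- one of its acute vertices, and a triangle not in a corner of Δ has a surplus
-- up-triangle at some interior point.  Hence the n triangles number at most 3 more than
-- the parallelograms.  Counting down-triangles gives #par + 3 #hex = n (n - 1) / 2, which
-- modulo 3 raises this bound to n - 1 unless 3 ∣ n.  Sharpness: each unit triangle has
-- exactly one vertex (a , b) with 3 ∣ a + 2 b; the unit triangles around such a vertex
-- form a hexagon, at a side of Δ a triangle and a parallelogram, in a corner a triangle.

module Submission where

open import Defs
open import Data.Empty using (⊥)
open import Data.Integer using (ℤ; +_; -[1+_]; 0ℤ; 1ℤ; -1ℤ; +≤+; -≤-)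
import Data.Integer as ℤ
import Data.Integer.Properties as ℤ
open import Data.List using (List; []; _∷_; _++_; map; concatMap; upTo; applyUpTo; cartesianProductWith)
open import Data.List.Membership.Propositional using (_∈_; find; lose)
open import Data.List.Membership.Propositional.Properties
  using (∈-map⁺; ∈-map⁻; ∈-++⁺ˡ; ∈-++⁺ʳ; ∈-++⁻; ∈-upTo⁺; ∈-upTo⁻; ∈-concatMap⁺; ∈-concatMap⁻)
open import Data.List.Membership.Propositional.Properties.WithK using (unique∧set⇒bag)
open import Data.List.Properties using (map-++; map-∘; map-cong)
open import Data.List.Relation.Binary.BagAndSetEquality using (∼bag⇒↭)
open import Data.List.Relation.Binary.Disjoint.Propositional using (Disjoint)
open import Data.List.Relation.Binary.Permutation.Propositional using (_↭_)
open import Data.List.Relation.Binary.Permutation.Propositional.Properties using (map⁺; ∈-resp-↭)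
open import Data.List.Relation.Unary.All as All using (All; []; _∷_)
import Data.List.Relation.Unary.All.Properties as All
open import Data.List.Relation.Unary.AllPairs as AllPairs using (AllPairs; []; _∷_)
import Data.List.Relation.Unary.AllPairs.Properties as AllPairs
open import Data.List.Relation.Unary.Any as Any using (Any; here; there)
import Data.List.Relation.Unary.Any.Properties as Any
open import Data.List.Relation.Unary.Unique.Propositional using (Unique)
import Data.List.Relation.Unary.Unique.Propositional.Properties as Unique
open import Data.Nat using (ℕ; zero; suc; z≤n; s≤s)
open import Data.Product using (_×_; _,_; Σ; ∃-syntax; proj₁; proj₂; map₂; uncurry)
open import Data.Product.Properties using (,-injectiveˡ)
open import Data.Sum using (_⊎_; inj₁; inj₂; reduce)
open import Function using (_∘_; id; mk⇔)
open import Relation.Binary.Definitions using (DecidableEquality)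
open import Relation.Binary.PropositionalEquality
open import Relation.Nullary using (¬_; Dec; yes; no; contradiction)
open import Relation.Nullary.Decidable using (True; from-yes; map′; toWitness; _×-dec_; _→-dec_)

-- Every cell, like every unit triangle, is cut out by bounds with integer ends on `x`, `y` and
-- `x + y`. Such a region cannot cut through an open unit triangle, so a single inner point decides
-- whether it contains the whole triangle. This reduces statements on rational points to a
-- permutation of finite lists, after which any weight on unit triangles can be summed in two ways.
--
-- Surpluses can be negative, whereas all sums here are of natural numbers. The surplus inequality
-- is therefore split into two sides, `demand` and `supply`, with every negative term moved across.
--
-- The colouring is tuned to the corners of Δ: there `a + 2 b` takes the values 0, `n` and `2 n`, so
-- all three corners are coloured if 3 ∣ `n`, and only the origin otherwise. There are always `n`
-- triangles, one in each coloured corner star, while every other star has as many triangles as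
-- parallelograms. Hence the parallelograms number `n` minus the coloured corners.

module Geometry where

  import Data.Integer.DivMod as ℤ using ([n/d]*d≤n; n<s[n/ℕd]*d; div-pos-is-/ℕ)
  import Data.Integer.Solver as ℤ
  import Data.Nat as ℕ
  open import Data.Rational
    using (ℚ; mkℚ; 0ℚ; 1ℚ; _/_; _+_; _-_; -_; _≤_; _<_; _⊔_; ∣_∣; floor; toℚᵘ)
  open import Data.Rational.Properties
  open import Data.Rational.Solver using (module +-*-Solver)
  open import Data.Rational.Unnormalised using (mkℚᵘ; *≡*; *≤*; *<*)
  import Data.Rational.Unnormalised as ℚᵘ
  import Data.Rational.Unnormalised.Properties as ℚᵘ

  -- Lattice boxes in the rational plane

  -- A certificate for linear arithmetic: `p ≤ q` is a sum of known inequalities, and the ring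
  -- solver checks that the differences agree.
  ≤-by : ∀ {p q x y} → p ≤ q → y - x ≡ q - p → x ≤ y
  ≤-by {p} {q} {x} {y} p≤q eq = subst₂ _≤_
    (solve 2 (λ x p → x :- p :+ p := x) refl x p)
    (trans (solve 3 (λ x p q → x :- p :+ q := x :+ (q :- p)) refl x p q)
           (trans (cong (_+_ x) (sym eq)) (solve 2 (λ x y → x :+ (y :- x) := y) refl x y)))
    (+-monoʳ-≤ (x - p) p≤q)
    where open +-*-Solver

  <-by : ∀ {p q x y} → p < q → y - x ≡ q - p → x < y
  <-by {p} {q} {x} {y} p<q eq = subst₂ _<_
    (solve 2 (λ x p → x :- p :+ p := x) refl x p)
    (trans (solve 3 (λ x p q → x :- p :+ q := x :+ (q :- p)) refl x p q)
           (trans (cong (_+_ x) (sym eq)) (solve 2 (λ x y → x :+ (y :- x) := y) refl x y)))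
    (+-monoʳ-< (x - p) p<q)
    where open +-*-Solver

  toℚᵘ-ℤ→ℚ : ∀ z → toℚᵘ (ℤ→ℚ z) ℚᵘ.≃ mkℚᵘ z 0
  toℚᵘ-ℤ→ℚ z = toℚᵘ-fromℚᵘ (mkℚᵘ z 0)

  ℤ→ℚ-+ : ∀ a b → ℤ→ℚ (a ℤ.+ b) ≡ ℤ→ℚ a + ℤ→ℚ b
  ℤ→ℚ-+ a b = toℚᵘ-injective (begin
    toℚᵘ (ℤ→ℚ (a ℤ.+ b))                ≈⟨ toℚᵘ-ℤ→ℚ (a ℤ.+ b) ⟩
    mkℚᵘ (a ℤ.+ b) 0                    ≈⟨ *≡* (cong (ℤ._* + 1) (sym (cong₂ ℤ._+_ (ℤ.*-identityʳ a) (ℤ.*-identityʳ b)))) ⟩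
    mkℚᵘ a 0 ℚᵘ.+ mkℚᵘ b 0              ≈⟨ ℚᵘ.+-cong (toℚᵘ-ℤ→ℚ a) (toℚᵘ-ℤ→ℚ b) ⟨
    toℚᵘ (ℤ→ℚ a) ℚᵘ.+ toℚᵘ (ℤ→ℚ b)      ≈⟨ toℚᵘ-homo-+ (ℤ→ℚ a) (ℤ→ℚ b) ⟨
    toℚᵘ (ℤ→ℚ a + ℤ→ℚ b)                ∎)
    where open import Relation.Binary.Reasoning.Setoid ℚᵘ.≃-setoid

  ℤ→ℚ-mono-≤ : ∀ {a b} → a ℤ.≤ b → ℤ→ℚ a ≤ ℤ→ℚ b
  ℤ→ℚ-mono-≤ {a} {b} a≤b = toℚᵘ-cancel-≤
    (ℚᵘ.≤-respˡ-≃ (ℚᵘ.≃-sym (toℚᵘ-ℤ→ℚ a)) (ℚᵘ.≤-respʳ-≃ (ℚᵘ.≃-sym (toℚᵘ-ℤ→ℚ b))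
      (*≤* (ℤ.*-monoʳ-≤-nonNeg (+ 1) a≤b))))

  ℤ→ℚ-cancel-< : ∀ {a b} → ℤ→ℚ a < ℤ→ℚ b → a ℤ.< b
  ℤ→ℚ-cancel-< {a} {b} ιa<ιb = ℤ.≰⇒> λ b≤a → <-irrefl refl (<-≤-trans ιa<ιb (ℤ→ℚ-mono-≤ b≤a))

  ℤ→ℚ-suc : ∀ a → ℤ→ℚ (ℤ.suc a) ≡ 1ℚ + ℤ→ℚ a
  ℤ→ℚ-suc = ℤ→ℚ-+ (+ 1)

  floor-≤ : ∀ x → ℤ→ℚ (floor x) ≤ x
  floor-≤ x@(mkℚ n d-1 _) = toℚᵘ-cancel-≤ (ℚᵘ.≤-respˡ-≃ (ℚᵘ.≃-sym (toℚᵘ-ℤ→ℚ (floor x)))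
    (*≤* (subst ((floor x ℤ.* + ℕ.suc d-1) ℤ.≤_) (sym (ℤ.*-identityʳ n)) (ℤ.[n/d]*d≤n n (+ ℕ.suc d-1)))))

  <-suc-floor : ∀ x → x < ℤ→ℚ (ℤ.suc (floor x))
  <-suc-floor x@(mkℚ n d-1 _) = toℚᵘ-cancel-< (ℚᵘ.<-respʳ-≃ (ℚᵘ.≃-sym (toℚᵘ-ℤ→ℚ (ℤ.suc (floor x))))
    (*<* (subst₂ ℤ._<_ (sym (ℤ.*-identityʳ n))
      (cong (λ z → ℤ.suc z ℤ.* + ℕ.suc d-1) (sym (ℤ.div-pos-is-/ℕ n (ℕ.suc d-1))))
      (ℤ.n<s[n/ℕd]*d n (ℕ.suc d-1)))))

  Interval : Set
  Interval = ℤ × ℤ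

  infix 4 _∈[_] _∈⟨_⟩ _⊆ᴵ_

  record _∈[_] (x : ℚ) (I : Interval) : Set where
    constructor _,_
    field
      lower : ℤ→ℚ (proj₁ I) ≤ x
      upper : x ≤ ℤ→ℚ (proj₂ I)

  record _∈⟨_⟩ (x : ℚ) (I : Interval) : Set where
    constructor _,_
    field
      lower : ℤ→ℚ (proj₁ I) < x
      upper : x < ℤ→ℚ (proj₂ I)

  record _⊆ᴵ_ (I J : Interval) : Set where
    constructor _,_
    field
      lower : proj₁ J ℤ.≤ proj₁ I
      upper : proj₂ I ℤ.≤ proj₂ J

  unit : ℤ → Interval
  unit i = i , ℤ.suc i

  ⊆ᴵ-sound : ∀ {I J x} → I ⊆ᴵ J → x ∈[ I ] → x ∈[ J ]
  ⊆ᴵ-sound (l′≤l , h≤h′) (l≤x , x≤h) = ≤-trans (ℤ→ℚ-mono-≤ l′≤l) l≤x , ≤-trans x≤h (ℤ→ℚ-mono-≤ h≤h′)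

  <-suc⇒≤ : ∀ {i j} → i ℤ.< ℤ.suc j → i ℤ.≤ j
  <-suc⇒≤ {i} {j} i<1+j = subst₂ ℤ._≤_ (ℤ.pred-suc i) (ℤ.pred-suc j) (ℤ.+-monoʳ-≤ (-[1+ 0 ]) (ℤ.i<j⇒suc[i]≤j i<1+j))

  ≤-unit : ∀ {l i x} → ℤ→ℚ l ≤ x → x ∈⟨ unit i ⟩ → l ℤ.≤ i
  ≤-unit {i = i} l≤x (_ , x<1+i) = <-suc⇒≤ {j = i} (ℤ→ℚ-cancel-< {b = ℤ.suc i} (≤-<-trans l≤x x<1+i))

  unit-≤ : ∀ {h i x} → x ≤ ℤ→ℚ h → x ∈⟨ unit i ⟩ → ℤ.suc i ℤ.≤ h
  unit-≤ {i = i} x≤h (i<x , _) = ℤ.i<j⇒suc[i]≤j (ℤ→ℚ-cancel-< {a = i} (<-≤-trans i<x x≤h))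

  -- The ends of `J` are integers, and no integer lies strictly between `i` and `i + 1`.
  ⊆ᴵ-complete : ∀ {i J x} → x ∈⟨ unit i ⟩ → x ∈[ J ] → unit i ⊆ᴵ J
  ⊆ᴵ-complete {i} x∈i (l≤x , x≤h) = ≤-unit {i = i} l≤x x∈i , unit-≤ {i = i} x≤h x∈i

  -- Cells as unions of unit triangles

  record Box : Set where
    constructor box
    field
      xs ys ss : Interval

  record _∈ᴮ_ (p : Point) (B : Box) : Set where
    constructor in-box
    field
      x∈  : proj₁ p ∈[ Box.xs B ]
      y∈  : proj₂ p ∈[ Box.ys B ]
      s∈  : proj₁ p + proj₂ p ∈[ Box.ss B ]

  record _⊆_ (A B : Box) : Set where
    constructor sub-box
    field
      xs⊆ : Box.xs A ⊆ᴵ Box.xs B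
      ys⊆ : Box.ys A ⊆ᴵ Box.ys B
      ss⊆ : Box.ss A ⊆ᴵ Box.ss B

  ⊆-sound : ∀ {A B p} → A ⊆ B → p ∈ᴮ A → p ∈ᴮ B
  ⊆-sound (sub-box a b c) (in-box x y s) = in-box (⊆ᴵ-sound a x) (⊆ᴵ-sound b y) (⊆ᴵ-sound c s)

  -- △ i j has the vertices (i, j), (i+1, j), (i, j+1); ▽ i j has the vertices
  -- (i+1, j), (i, j+1), (i+1, j+1).
  data Tile : Set where
    △ ▽ : ℤ → ℤ → Tile

  col row diag : Tile → ℤ
  col (△ i j) = i
  col (▽ i j) = i
  row (△ i j) = j
  row (▽ i j) = j
  diag (△ i j) = i ℤ.+ j
  diag (▽ i j) = ℤ.suc (i ℤ.+ j)

  tileBox : Tile → Box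
  tileBox τ = box (unit (col τ)) (unit (row τ)) (unit (diag τ))

  record _∈°_ (p : Point) (τ : Tile) : Set where
    constructor in-tile
    field
      x∈ : proj₁ p ∈⟨ unit (col τ) ⟩
      y∈ : proj₂ p ∈⟨ unit (row τ) ⟩
      s∈ : proj₁ p + proj₂ p ∈⟨ unit (diag τ) ⟩

  ⊆-complete : ∀ {τ B p} → p ∈° τ → p ∈ᴮ B → tileBox τ ⊆ B
  ⊆-complete (in-tile x y s) (in-box x′ y′ s′) =
    sub-box (⊆ᴵ-complete x x′) (⊆ᴵ-complete y y′) (⊆ᴵ-complete s s′)

  -- Translations by lattice vectors

  shift : ℤ → ℤ → Tile → Tile
  shift u v (△ i j) = △ (i ℤ.+ u) (j ℤ.+ v)
  shift u v (▽ i j) = ▽ (i ℤ.+ u) (j ℤ.+ v)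

  unshift : ℤ → ℤ → Tile → Tile
  unshift u v = shift (ℤ.- u) (ℤ.- v)

  cancel-shift : ∀ i u → i ℤ.+ ℤ.- u ℤ.+ u ≡ i
  cancel-shift = solve 2 (λ i u → i :+ :- u :+ u := i) refl
    where open ℤ.+-*-Solver

  cancel-unshift : ∀ i u → i ℤ.+ u ℤ.+ ℤ.- u ≡ i
  cancel-unshift = solve 2 (λ i u → i :+ u :+ :- u := i) refl
    where open ℤ.+-*-Solver

  shift-unshift : ∀ u v τ → shift u v (unshift u v τ) ≡ τ
  shift-unshift u v (△ i j) = cong₂ △ (cancel-shift i u) (cancel-shift j v)
  shift-unshift u v (▽ i j) = cong₂ ▽ (cancel-shift i u) (cancel-shift j v)

  unshift-shift : ∀ u v τ → unshift u v (shift u v τ) ≡ τ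
  unshift-shift u v (△ i j) = cong₂ △ (cancel-unshift i u) (cancel-unshift j v)
  unshift-shift u v (▽ i j) = cong₂ ▽ (cancel-unshift i u) (cancel-unshift j v)

  col-unshift : ∀ u v τ → col (unshift u v τ) ≡ col τ ℤ.- u
  col-unshift u v (△ i j) = refl
  col-unshift u v (▽ i j) = refl

  row-unshift : ∀ u v τ → row (unshift u v τ) ≡ row τ ℤ.- v
  row-unshift u v (△ i j) = refl
  row-unshift u v (▽ i j) = refl

  diag-unshift : ∀ u v τ → diag (unshift u v τ) ≡ diag τ ℤ.- (u ℤ.+ v)
  diag-unshift u v (△ i j) =
    solve 4 (λ i j u v → i :+ :- u :+ (j :+ :- v) := i :+ j :+ :- (u :+ v)) refl i j u v
    where open ℤ.+-*-Solver
  diag-unshift u v (▽ i j) =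
    solve 4 (λ i j u v → con (+ 1) :+ (i :+ :- u :+ (j :+ :- v))
        := con (+ 1) :+ (i :+ j) :+ :- (u :+ v)) refl i j u v
    where open ℤ.+-*-Solver

  ℤ→ℚ-minus : ∀ a b → ℤ→ℚ (a ℤ.- b) ≡ ℤ→ℚ a - ℤ→ℚ b
  ℤ→ℚ-minus a b = begin
    ℤ→ℚ (a ℤ.- b)                      ≡⟨ solve 2 (λ c b → c := c :+ b :- b) refl (ℤ→ℚ (a ℤ.- b)) (ℤ→ℚ b) ⟩
    ℤ→ℚ (a ℤ.- b) + ℤ→ℚ b - ℤ→ℚ b      ≡⟨ cong (_- ℤ→ℚ b) (ℤ→ℚ-+ (a ℤ.- b) b) ⟨
    ℤ→ℚ (a ℤ.- b ℤ.+ b) - ℤ→ℚ b        ≡⟨ cong (λ c → ℤ→ℚ c - ℤ→ℚ b) (cancel-shift a b) ⟩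
    ℤ→ℚ a - ℤ→ℚ b                      ∎
    where open ≡-Reasoning
          open +-*-Solver

  suc-minus : ∀ i u → ℤ.suc (i ℤ.- u) ≡ ℤ.suc i ℤ.- u
  suc-minus = solve 2 (λ i u → con (+ 1) :+ (i :- u) := con (+ 1) :+ i :- u) refl
    where open ℤ.+-*-Solver

  unit-minus : ∀ {x i} u → x ∈[ unit i ] → x - ℤ→ℚ u ∈[ unit (i ℤ.- u) ]
  unit-minus {x} {i} u (l , h) =
    subst (_≤ x - ℤ→ℚ u) (sym (ℤ→ℚ-minus i u)) (+-monoˡ-≤ (- ℤ→ℚ u) l) ,
    subst (x - ℤ→ℚ u ≤_) (sym (trans (cong ℤ→ℚ (suc-minus i u)) (ℤ→ℚ-minus (ℤ.suc i) u))) (+-monoˡ-≤ (- ℤ→ℚ u) h)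

  unit-minus° : ∀ {x i} u → x ∈⟨ unit i ⟩ → x - ℤ→ℚ u ∈⟨ unit (i ℤ.- u) ⟩
  unit-minus° {x} {i} u (l , h) =
    subst (_< x - ℤ→ℚ u) (sym (ℤ→ℚ-minus i u)) (+-monoˡ-< (- ℤ→ℚ u) l) ,
    subst (x - ℤ→ℚ u <_) (sym (trans (cong ℤ→ℚ (suc-minus i u)) (ℤ→ℚ-minus (ℤ.suc i) u))) (+-monoˡ-< (- ℤ→ℚ u) h)

  sum-minus : ∀ x y u v → x + y - ℤ→ℚ (u ℤ.+ v) ≡ (x - ℤ→ℚ u) + (y - ℤ→ℚ v)
  sum-minus x y u v = trans (cong (λ c → x + y - c) (ℤ→ℚ-+ u v))
    (solve 4 (λ x y u v → x :+ y :- (u :+ v) := (x :- u) :+ (y :- v)) refl x y (ℤ→ℚ u) (ℤ→ℚ v))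
    where open +-*-Solver

  ∈-unshift : ∀ {x y} u v τ → (x , y) ∈ᴮ tileBox τ → (x - ℤ→ℚ u , y - ℤ→ℚ v) ∈ᴮ tileBox (unshift u v τ)
  ∈-unshift {x} {y} u v τ (in-box a b c) = in-box
    (subst (λ i → _ ∈[ unit i ]) (sym (col-unshift u v τ)) (unit-minus u a))
    (subst (λ i → _ ∈[ unit i ]) (sym (row-unshift u v τ)) (unit-minus v b))
    (subst₂ (λ z i → z ∈[ unit i ]) (sum-minus x y u v) (sym (diag-unshift u v τ)) (unit-minus (u ℤ.+ v) c))

  ∈°-unshift : ∀ {x y} u v τ → (x , y) ∈° τ → (x - ℤ→ℚ u , y - ℤ→ℚ v) ∈° unshift u v τ
  ∈°-unshift {x} {y} u v τ (in-tile a b c) = in-tile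
    (subst (λ i → _ ∈⟨ unit i ⟩) (sym (col-unshift u v τ)) (unit-minus° u a))
    (subst (λ i → _ ∈⟨ unit i ⟩) (sym (row-unshift u v τ)) (unit-minus° v b))
    (subst₂ (λ z i → z ∈⟨ unit i ⟩) (sum-minus x y u v) (sym (diag-unshift u v τ)) (unit-minus° (u ℤ.+ v) c))

  -- The extreme values of `x`, `y` and `x + y` on the Minkowski sum: these three forms take the
  -- values -1, 1, 0 on ē₁, then 0, -1, -1 on ē₂, and 1, 0, 1 on ē₃, while on c·T each ranges from 0
  -- to c.
  shapeBox : Shape → Box
  shapeBox s = box (ℤ.- w₁ , c ℤ.+ w₃) (ℤ.- w₂ , c ℤ.+ w₁) (ℤ.- w₂ , c ℤ.+ w₃)
    where
    c = + c-of s
    w₁ = + w₁-of s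
    w₂ = + w₂-of s
    w₃ = + w₃-of s

  InShape : Shape → Point → Set
  InShape s = InP (c-of s) (w₁-of s) (w₂-of s) (w₃-of s)

  ℤ→ℚ-neg : ∀ a → ℤ→ℚ (ℤ.- a) ≡ - ℤ→ℚ a
  ℤ→ℚ-neg a = trans (cong ℤ→ℚ (sym (ℤ.+-identityˡ (ℤ.- a)))) (trans (ℤ→ℚ-minus (+ 0) a) (+-identityˡ (- ℤ→ℚ a)))

  InShape⇒∈ᴮ : ∀ s {p} → InShape s p → p ∈ᴮ shapeBox s
  InShape⇒∈ᴮ s {x , y} (a , b , l₁ , l₂ , l₃ , 0≤a , 0≤b , a+b≤c , 0≤l₁ , l₁≤w₁ ,
                             0≤l₂ , l₂≤w₂ , 0≤l₃ , l₃≤w₃ , refl , refl) = in-box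
    ( subst (_≤ x) (sym (ℤ→ℚ-neg (+ w₁-of s)))
        (≤-by (+-mono-≤ (+-mono-≤ 0≤a 0≤l₃) l₁≤w₁)
          (solve 4 (λ a l₁ l₃ w → a :- l₁ :+ l₃ :- (:- w)
              := a :+ l₃ :+ w :- (con 0ℚ :+ con 0ℚ :+ l₁)) refl a l₁ l₃ W₁))
    , subst (x ≤_) (sym (ℤ→ℚ-+ (+ c-of s) (+ w₃-of s)))
        (≤-by (+-mono-≤ (+-mono-≤ a+b≤c 0≤b) (+-mono-≤ 0≤l₁ l₃≤w₃))
          (solve 6 (λ a b l₁ l₃ c w → c :+ w :- (a :- l₁ :+ l₃)
              := c :+ b :+ (l₁ :+ w) :- (a :+ b :+ con 0ℚ :+ (con 0ℚ :+ l₃))) refl a b l₁ l₃ C W₃)))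
    ( subst (_≤ y) (sym (ℤ→ℚ-neg (+ w₂-of s)))
        (≤-by (+-mono-≤ (+-mono-≤ 0≤b 0≤l₁) l₂≤w₂)
          (solve 4 (λ b l₁ l₂ w → b :+ l₁ :- l₂ :- (:- w)
              := b :+ l₁ :+ w :- (con 0ℚ :+ con 0ℚ :+ l₂)) refl b l₁ l₂ W₂))
    , subst (y ≤_) (sym (ℤ→ℚ-+ (+ c-of s) (+ w₁-of s)))
        (≤-by (+-mono-≤ (+-mono-≤ a+b≤c 0≤a) (+-mono-≤ 0≤l₂ l₁≤w₁))
          (solve 6 (λ a b l₁ l₂ c w → c :+ w :- (b :+ l₁ :- l₂)
              := c :+ a :+ (l₂ :+ w) :- (a :+ b :+ con 0ℚ :+ (con 0ℚ :+ l₁))) refl a b l₁ l₂ C W₁)))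
    ( subst (_≤ x + y) (sym (ℤ→ℚ-neg (+ w₂-of s)))
        (≤-by (+-mono-≤ (+-mono-≤ 0≤a 0≤b) (+-mono-≤ 0≤l₃ l₂≤w₂))
          (solve 6 (λ a b l₁ l₂ l₃ w → a :- l₁ :+ l₃ :+ (b :+ l₁ :- l₂) :- (:- w)
              := a :+ b :+ (l₃ :+ w) :- (con 0ℚ :+ con 0ℚ :+ (con 0ℚ :+ l₂))) refl a b l₁ l₂ l₃ W₂))
    , subst (x + y ≤_) (sym (ℤ→ℚ-+ (+ c-of s) (+ w₃-of s)))
        (≤-by (+-mono-≤ (+-mono-≤ a+b≤c 0≤l₂) l₃≤w₃)
          (solve 7 (λ a b l₁ l₂ l₃ c w → c :+ w :- (a :- l₁ :+ l₃ :+ (b :+ l₁ :- l₂))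
              := c :+ l₂ :+ w :- (a :+ b :+ con 0ℚ :+ l₃)) refl a b l₁ l₂ l₃ C W₃)))
    where
    open +-*-Solver
    C = ℕ→ℚ (c-of s)
    W₁ = ℕ→ℚ (w₁-of s)
    W₂ = ℕ→ℚ (w₂-of s)
    W₃ = ℕ→ℚ (w₃-of s)

  -- l₁ is the least coefficient of ē₁ for which the coefficients of ē₂ and ē₃
  -- are forced to be nonnegative.
  zonotope : ∀ {w₁ w₂ w₃ x y} → (x , y) ∈ᴮ box (ℤ.- + w₁ , + w₃) (ℤ.- + w₂ , + w₁) (ℤ.- + w₂ , + w₃) →
             InP 0 w₁ w₂ w₃ (x , y)
  zonotope {w₁} {w₂} {w₃} {x} {y} (in-box (x≥ , x≤) (y≥ , y≤) (s≥ , s≤)) =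
    0ℚ , 0ℚ , l₁ , l₁ - y , l₁ + x , ≤-refl , ≤-refl , ≤-refl ,
    -- The upper bounds on the three coefficients `l₁`, `l₁ - y` and `l₁ + x` become, over the three
    -- terms of the maximum, nine inequalities: the six bounds of the box and 0 ≤ wᵢ for each i.
    p≤p⊔q 0ℚ (- x ⊔ y) , ⊔-lub {y = 0ℚ} { - x ⊔ y} (nonNeg w₁) (⊔-lub {y = - x} {y} -x≤ y≤) ,
    ≤-by y≤l₁ (solve 2 (λ l y → l :- y :- con 0ℚ := l :- y) refl l₁ y) ,
    ≤-by (⊔-lub {W₂ + y} {0ℚ} { - x ⊔ y}
            (≤-by -y≤ (solve 2 (λ w y → w :+ y :- con 0ℚ := w :- (:- y)) refl W₂ y))
            (⊔-lub {y = - x} {y} (≤-by -s≤ (solve 3 (λ w x y → w :+ y :- (:- x)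
                := w :- (:- (x :+ y))) refl W₂ x y))
                   (≤-by (nonNeg w₂) (solve 2 (λ w y → w :+ y :- y := w :- con 0ℚ) refl W₂ y))))
         (solve 3 (λ l y w → w :- (l :- y) := w :+ y :- l) refl l₁ y W₂) ,
    ≤-by -x≤l₁ (solve 2 (λ l x → l :+ x :- con 0ℚ := l :- (:- x)) refl l₁ x) ,
    ≤-by (⊔-lub {W₃ - x} {0ℚ} { - x ⊔ y}
            (≤-by x≤ (solve 2 (λ w x → w :- x :- con 0ℚ := w :- x) refl W₃ x))
            (⊔-lub {y = - x} {y} (≤-by (nonNeg w₃) (solve 2 (λ w x → w :- x :- (:- x)
                := w :- con 0ℚ) refl W₃ x))
                   (≤-by s≤ (solve 3 (λ w x y → w :- x :- y := w :- (x :+ y)) refl W₃ x y))))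
         (solve 3 (λ l x w → w :- (l :+ x) := w :- x :- l) refl l₁ x W₃) ,
    solve 2 (λ l x → x := con 0ℚ :- l :+ (l :+ x)) refl l₁ x ,
    solve 2 (λ l y → y := con 0ℚ :+ l :- (l :- y)) refl l₁ y
    where
    open +-*-Solver
    W₂ = ℕ→ℚ w₂
    W₃ = ℕ→ℚ w₃
    l₁ = 0ℚ ⊔ (- x ⊔ y)
    nonNeg : ∀ w → 0ℚ ≤ ℕ→ℚ w
    nonNeg w = ℤ→ℚ-mono-≤ {+ 0} {+ w} (+≤+ ℕ.z≤n)
    neg : ∀ w {z} → ℤ→ℚ (ℤ.- + w) ≤ z → - z ≤ ℕ→ℚ w
    neg w {z} h = ≤-by (subst (_≤ z) (ℤ→ℚ-neg (+ w)) h) (solve 2 (λ w z → w :- (:- z)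
        := z :- (:- w)) refl (ℕ→ℚ w) z)
    -x≤ = neg w₁ x≥
    -y≤ = neg w₂ y≥
    -s≤ = neg w₂ s≥
    -x≤l₁ : - x ≤ l₁
    -x≤l₁ = ≤-trans (p≤p⊔q (- x) y) (p≤q⊔p 0ℚ (- x ⊔ y))
    y≤l₁ : y ≤ l₁
    y≤l₁ = ≤-trans (p≤q⊔p (- x) y) (p≤q⊔p 0ℚ (- x ⊔ y))

  ∈ᴮ⇒InShape : ∀ s {p} → p ∈ᴮ shapeBox s → InShape s p
  ∈ᴮ⇒InShape tri {x , y} (in-box (x≥ , _) (y≥ , _) (_ , s≤)) =
    x , y , 0ℚ , 0ℚ , 0ℚ , x≥ , y≥ , s≤ , ≤-refl , ≤-refl , ≤-refl , ≤-refl , ≤-refl , ≤-refl ,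
    solve 1 (λ x → x := x :- con 0ℚ :+ con 0ℚ) refl x ,
    solve 1 (λ x → x := x :+ con 0ℚ :- con 0ℚ) refl y
    where open +-*-Solver
  ∈ᴮ⇒InShape par₁₂ = zonotope {1} {1} {0}
  ∈ᴮ⇒InShape par₁₃ = zonotope {1} {0} {1}
  ∈ᴮ⇒InShape par₂₃ = zonotope {0} {1} {1}
  ∈ᴮ⇒InShape hex   = zonotope {1} {1} {1}

  infix 4 _⊑_

  record _⊑_ (τ : Tile) (C : Cell) : Set where
    constructor sub-cell
    field
      box⊆ : tileBox (unshift (u C) (v C) τ) ⊆ shapeBox (shape C)

  ⊑-sound : ∀ {τ C p} → τ ⊑ C → p ∈ᴮ tileBox τ → p ∈C C
  ⊑-sound {τ} {C} {p} (sub-cell τ⊑C) p∈τ = ∈ᴮ⇒InShape (shape C) (⊆-sound τ⊑C (∈-unshift (u C) (v C) τ p∈τ))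

  ⊑-complete : ∀ {τ C p} → p ∈° τ → p ∈C C → τ ⊑ C
  ⊑-complete {τ} {C} {p} p∈τ p∈C = sub-cell (⊆-complete (∈°-unshift (u C) (v C) τ p∈τ) (InShape⇒∈ᴮ (shape C) p∈C))

  -- The unit triangles that make up each shape

  tilesOf : Shape → List Tile
  tilesOf tri   = △ 0ℤ 0ℤ ∷ []
  tilesOf par₁₂ = △ -1ℤ 0ℤ ∷ ▽ -1ℤ -1ℤ ∷ []
  tilesOf par₁₃ = △ 0ℤ 0ℤ ∷ ▽ -1ℤ 0ℤ ∷ []
  tilesOf par₂₃ = △ 0ℤ -1ℤ ∷ ▽ 0ℤ -1ℤ ∷ []
  tilesOf hex   = △ -1ℤ 0ℤ ∷ △ 0ℤ -1ℤ ∷ △ 0ℤ 0ℤ ∷ ▽ -1ℤ -1ℤ ∷ ▽ -1ℤ 0ℤ ∷ ▽ 0ℤ -1ℤ ∷ []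

  tiles : Cell → List Tile
  tiles C = map (shift (u C) (v C)) (tilesOf (shape C))

  _⊆ᴵ?_ : ∀ I J → Dec (I ⊆ᴵ J)
  (l , h) ⊆ᴵ? (l′ , h′) = map′ (λ (a , b) → a , b) (λ (a , b) → a , b) (l′ ℤ.≤? l ×-dec h ℤ.≤? h′)

  _⊆?_ : ∀ A B → Dec (A ⊆ B)
  box a b c ⊆? box a′ b′ c′ = map′ (λ (p , q , r) → sub-box p q r) (λ (sub-box p q r) → p , q , r)
    (a ⊆ᴵ? a′ ×-dec b ⊆ᴵ? b′ ×-dec c ⊆ᴵ? c′)

  tilesOf-⊆ : ∀ s → All (λ τ → tileBox τ ⊆ shapeBox s) (tilesOf s)
  tilesOf-⊆ s = toWitness {a? = All.all? (λ τ → tileBox τ ⊆? shapeBox s) (tilesOf s)} (check s)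
    where
    check : ∀ s → True (All.all? (λ τ → tileBox τ ⊆? shapeBox s) (tilesOf s))
    check tri   = _
    check par₁₂ = _
    check par₁₃ = _
    check par₂₃ = _
    check hex   = _

  data Unit : ℤ → Set where
    -one : Unit -1ℤ
    zero : Unit 0ℤ

  unit? : ∀ {i} → -1ℤ ℤ.≤ i → ℤ.suc i ℤ.≤ 1ℤ → Unit i
  unit? {+ ℕ.zero}          _           _                       = zero
  unit? {+ ℕ.suc n}         _           (+≤+ (ℕ.s≤s ()))
  unit? { -[1+ ℕ.zero ]}    _           _                       = -one
  unit? { -[1+ ℕ.suc n ]}   (-≤- ())    _

  ⊆ᴵ-trans : ∀ {I J K} → I ⊆ᴵ J → J ⊆ᴵ K → I ⊆ᴵ K
  ⊆ᴵ-trans (a , b) (c , d) = ℤ.≤-trans c a , ℤ.≤-trans b d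

  _≟ᵀ_ : DecidableEquality Tile
  △ i j ≟ᵀ △ k l = map′ (λ { (refl , refl) → refl }) (λ { refl → refl , refl }) (i ℤ.≟ k ×-dec j ℤ.≟ l)
  △ i j ≟ᵀ ▽ k l = no λ ()
  ▽ i j ≟ᵀ △ k l = no λ ()
  ▽ i j ≟ᵀ ▽ k l = map′ (λ { (refl , refl) → refl }) (λ { refl → refl , refl }) (i ℤ.≟ k ×-dec j ℤ.≟ l)

  open import Data.List.Membership.DecPropositional _≟ᵀ_ using (_∈?_)

  nearTiles : List Tile
  nearTiles = cartesianProductWith △ units units ++ cartesianProductWith ▽ units units
    where units = -1ℤ ∷ 0ℤ ∷ []

  near : ∀ {τ} → Unit (col τ) → Unit (row τ) → τ ∈ nearTiles
  near {△ _ _} -one -one = here refl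
  near {△ _ _} -one zero = there (here refl)
  near {△ _ _} zero -one = there (there (here refl))
  near {△ _ _} zero zero = there (there (there (here refl)))
  near {▽ _ _} -one -one = there (there (there (there (here refl))))
  near {▽ _ _} -one zero = there (there (there (there (there (here refl)))))
  near {▽ _ _} zero -one = there (there (there (there (there (there (here refl))))))
  near {▽ _ _} zero zero = there (there (there (there (there (there (there (here refl)))))))

  shapeBox-near : ∀ s → Box.xs (shapeBox s) ⊆ᴵ (-1ℤ , 1ℤ) × Box.ys (shapeBox s) ⊆ᴵ (-1ℤ , 1ℤ)
  shapeBox-near s = toWitness {a? = _ ⊆ᴵ? _ ×-dec _ ⊆ᴵ? _} (check s)
    where
    check : ∀ s → True (Box.xs (shapeBox s) ⊆ᴵ? (-1ℤ , 1ℤ) ×-dec Box.ys (shapeBox s) ⊆ᴵ? (-1ℤ , 1ℤ))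
    check tri   = _
    check par₁₂ = _
    check par₁₃ = _
    check par₂₃ = _
    check hex   = _

  -- All shapes fit into the square [-1, 1]², which leaves -1 and 0 as column and row of `τ`. The
  -- eight remaining tiles are checked by decision.
  ⊆-tilesOf : ∀ s {τ} → tileBox τ ⊆ shapeBox s → τ ∈ tilesOf s
  ⊆-tilesOf s {τ} τ⊆s@(sub-box x y _) with ⊆ᴵ-trans x (proj₁ (shapeBox-near s)) | ⊆ᴵ-trans y (proj₂ (shapeBox-near s))
  ... | xl , xh | yl , yh = All.lookup all-near (near {τ} (unit? xl xh) (unit? yl yh)) τ⊆s
    where
    near? : ∀ s → Dec (All (λ τ → tileBox τ ⊆ shapeBox s → τ ∈ tilesOf s) nearTiles)
    near? s = All.all? (λ τ → (tileBox τ ⊆? shapeBox s) →-dec (τ ∈? tilesOf s)) nearTiles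
    check : ∀ s → True (near? s)
    check tri   = _
    check par₁₂ = _
    check par₁₃ = _
    check par₂₃ = _
    check hex   = _
    all-near = toWitness {a? = near? s} (check s)

  ∈tiles⇒⊑ : ∀ {τ C} → τ ∈ tiles C → τ ⊑ C
  ∈tiles⇒⊑ {C = C} τ∈ with ∈-map⁻ _ τ∈
  ... | σ , σ∈ , refl = sub-cell (subst (λ σ → tileBox σ ⊆ shapeBox (shape C)) (sym (unshift-shift (u C) (v C) σ))
                          (All.lookup (tilesOf-⊆ (shape C)) σ∈))

  ⊑⇒∈tiles : ∀ {τ C} → τ ⊑ C → τ ∈ tiles C
  ⊑⇒∈tiles {τ} {C} (sub-cell τ⊑C) = subst (_∈ tiles C) (shift-unshift (u C) (v C) τ)
    (∈-map⁺ (shift (u C) (v C)) (⊆-tilesOf (shape C) τ⊑C))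

  -- Interior points and centroids of tiles

  <⇒≤-unit : ∀ {x i} → x ∈⟨ unit i ⟩ → x ∈[ unit i ]
  <⇒≤-unit (l , h) = <⇒≤ l , <⇒≤ h

  ∈°⇒∈ᴮ : ∀ {p} τ → p ∈° τ → p ∈ᴮ tileBox τ
  ∈°⇒∈ᴮ τ (in-tile a b c) = in-box (<⇒≤-unit a) (<⇒≤-unit b) (<⇒≤-unit c)

  ∣p∣<q⇒-q<p : ∀ {p q} → ∣ p ∣ < q → - q < p
  ∣p∣<q⇒-q<p {p} {q} ∣p∣<q with ∣p∣≡p∨∣p∣≡-p p
  ... | inj₁ eq = <-≤-trans (neg-antimono-< (≤-<-trans (0≤∣p∣ p) ∣p∣<q)) (subst (0ℚ ≤_) eq (0≤∣p∣ p))
  ... | inj₂ eq = <-by (subst (_< q) eq ∣p∣<q) (solve 2 (λ p q → p :- (:- q) := q :- (:- p)) refl p q)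
    where open +-*-Solver

  ∣p∣<q⇒p<q : ∀ {p q} → ∣ p ∣ < q → p < q
  ∣p∣<q⇒p<q {p} {q} ∣p∣<q = <-by (∣p∣<q⇒-q<p (subst (_< q) (sym (∣-p∣≡∣p∣ p)) ∣p∣<q))
    (solve 2 (λ p q → q :- p := :- p :- (:- q)) refl p q)
    where open +-*-Solver

  -- At a centroid, each of `x`, `y` and `x + y` is at distance 1/3 from the nearest integer. If `x`
  -- and `y` change by less than 1/6 each, then `x + y` changes by less than 1/3, so the open square
  -- of this radius stays in the open tile.
  ⅙ : ℚ
  ⅙ = + 1 / 6

  centroid : Tile → Point
  centroid (△ i j) = ℤ→ℚ i + (⅙ + ⅙) , ℤ→ℚ j + (⅙ + ⅙)
  centroid (▽ i j) = ℤ→ℚ i + (⅙ + ⅙ + (⅙ + ⅙)) , ℤ→ℚ j + (⅙ + ⅙ + (⅙ + ⅙))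

  -- With t = ⅙, the centroids are (i + 2t , j + 2t) and (i + 4t , j + 4t), and 1 = 6t.
  module _ {t : ℚ} (0<t : 0ℚ < t) where
    open +-*-Solver

    private
      6t 2t 4t : ℚ
      2t = t + t
      4t = 2t + 2t
      6t = 4t + 2t
      t> = +-mono-< 0<t 0<t

    △-bounds : ∀ x y i j → - t < x - (i + 2t) → x - (i + 2t) < t → - t < y - (j + 2t) → y - (j + 2t) < t →
               (i < x × x < 6t + i) × (i + j < x + y × x + y < 6t + (i + j))
    △-bounds x y i j x> x< y> y< =
      ( <-by (+-mono-< x> 0<t)
          (solve 3 (λ x i t → x :- i := x :- (i :+ (t :+ t)) :+ t :- (:- t :+ con 0ℚ)) refl x i t)
      , <-by (+-mono-< x< (+-mono-< 0<t t>))
          (solve 3 (λ x i t → (t :+ t :+ (t :+ t) :+ (t :+ t)) :+ i :- x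
              := t :+ (t :+ (t :+ t)) :- (x :- (i :+ (t :+ t)) :+ con 0ℚ)) refl x i t)) ,
      ( <-by (+-mono-< (+-mono-< x> y>) t>)
          (solve 5 (λ x y i j t → x :+ y :- (i :+ j)
              := x :- (i :+ (t :+ t)) :+ (y :- (j :+ (t :+ t))) :+ (t :+ t) :- (:- t :+ :- t :+ con 0ℚ))
              refl x y i j t)
      , <-by (+-mono-< x< y<)
          (solve 5 (λ x y i j t → (t :+ t :+ (t :+ t) :+ (t :+ t)) :+ (i :+ j) :- (x :+ y)
              := t :+ t :- (x :- (i :+ (t :+ t)) :+ (y :- (j :+ (t :+ t))))) refl x y i j t))

    ▽-bounds : ∀ x y i j → - t < x - (i + 4t) → x - (i + 4t) < t → - t < y - (j + 4t) → y - (j + 4t) < t →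
               (i < x × x < 6t + i) × (6t + (i + j) < x + y × x + y < 6t + (6t + (i + j)))
    ▽-bounds x y i j x> x< y> y< =
      ( <-by (+-mono-< x> (+-mono-< 0<t t>))
          (solve 3 (λ x i t → x :- i
              := x :- (i :+ (t :+ t :+ (t :+ t))) :+ (t :+ (t :+ t)) :- (:- t :+ con 0ℚ)) refl x i t)
      , <-by (+-mono-< x< 0<t)
          (solve 3 (λ x i t → (t :+ t :+ (t :+ t) :+ (t :+ t)) :+ i :- x
              := t :+ t :- (x :- (i :+ (t :+ t :+ (t :+ t))) :+ con 0ℚ)) refl x i t)) ,
      ( <-by (+-mono-< x> y>)
          (solve 5 (λ x y i j t → x :+ y :- (t :+ t :+ (t :+ t) :+ (t :+ t) :+ (i :+ j))
              := x :- (i :+ (t :+ t :+ (t :+ t))) :+ (y :- (j :+ (t :+ t :+ (t :+ t)))) :- (:- t :+ :- t))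
              refl x y i j t)
      , <-by (+-mono-< (+-mono-< x< y<) t>)
          (solve 5 (λ x y i j t → (t :+ t :+ (t :+ t) :+ (t :+ t)) :+ ((t :+ t :+ (t :+ t) :+ (t :+ t)) :+ (i :+ j)) :- (x :+ y)
              := t :+ t :+ (t :+ t) :- (x :- (i :+ (t :+ t :+ (t :+ t))) :+ (y :- (j :+ (t :+ t :+ (t :+ t)))) :+ con 0ℚ))
              refl x y i j t))

  0<⅙ : 0ℚ < ⅙
  0<⅙ = from-yes (0ℚ <? ⅙)

  ∈⟨unit⟩ : ∀ {x i z} → ℤ→ℚ i ≡ z → z < x × x < 1ℚ + z → x ∈⟨ unit i ⟩
  ∈⟨unit⟩ {x} {i} refl (l , h) = l , subst (x <_) (sym (ℤ→ℚ-suc i)) h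

  near-centroid : ∀ τ q → ∣ proj₁ q - proj₁ (centroid τ) ∣ < ⅙ → ∣ proj₂ q - proj₂ (centroid τ) ∣ < ⅙ → q ∈° τ
  near-centroid (△ i j) (x , y) dx dy = in-tile
    (∈⟨unit⟩ {i = i} refl (proj₁ (△-bounds 0<⅙ x y (ℤ→ℚ i) (ℤ→ℚ j) x> x< y> y<)))
    (∈⟨unit⟩ {i = j} refl (proj₁ (△-bounds 0<⅙ y x (ℤ→ℚ j) (ℤ→ℚ i) y> y< x> x<)))
    (∈⟨unit⟩ {i = i ℤ.+ j} (ℤ→ℚ-+ i j) (proj₂ (△-bounds 0<⅙ x y (ℤ→ℚ i) (ℤ→ℚ j) x> x< y> y<)))
    where
    x> = ∣p∣<q⇒-q<p dx
    x< = ∣p∣<q⇒p<q dx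
    y> = ∣p∣<q⇒-q<p dy
    y< = ∣p∣<q⇒p<q dy
  near-centroid (▽ i j) (x , y) dx dy = in-tile
    (∈⟨unit⟩ {i = i} refl (proj₁ (▽-bounds 0<⅙ x y (ℤ→ℚ i) (ℤ→ℚ j) x> x< y> y<)))
    (∈⟨unit⟩ {i = j} refl (proj₁ (▽-bounds 0<⅙ y x (ℤ→ℚ j) (ℤ→ℚ i) y> y< x> x<)))
    (∈⟨unit⟩ {i = ℤ.suc (i ℤ.+ j)} (trans (ℤ→ℚ-suc (i ℤ.+ j)) (cong (_+_ 1ℚ) (ℤ→ℚ-+ i j)))
      (proj₂ (▽-bounds 0<⅙ x y (ℤ→ℚ i) (ℤ→ℚ j) x> x< y> y<)))
    where
    x> = ∣p∣<q⇒-q<p dx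
    x< = ∣p∣<q⇒p<q dx
    y> = ∣p∣<q⇒-q<p dy
    y< = ∣p∣<q⇒p<q dy

  centroid∈° : ∀ τ → centroid τ ∈° τ
  centroid∈° τ = near-centroid τ (centroid τ) (small (proj₁ (centroid τ))) (small (proj₂ (centroid τ)))
    where
    small : ∀ x → ∣ x - x ∣ < ⅙
    small x = subst (λ d → ∣ d ∣ < ⅙) (sym (+-inverseʳ x)) 0<⅙

  centroid-interior : ∀ {τ C} → τ ⊑ C → InteriorOf C (centroid τ)
  centroid-interior {τ} {C} τ⊑C = ⅙ , 0<⅙ , λ q dx dy →
     ⊑-sound {τ} {C} τ⊑C (∈°⇒∈ᴮ τ (near-centroid τ q dx dy))

  -- Tiles and cells inside Δ, and tiles near a given point

  record InΔ (n : ℕ) (τ : Tile) : Set where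
    constructor in-Δ
    field
      0≤col  : 0ℤ ℤ.≤ col τ
      0≤row  : 0ℤ ℤ.≤ row τ
      diag<n : ℤ.suc (diag τ) ℤ.≤ + n

  Δ-complete : ∀ {n τ p} → p ∈° τ → p ∈Δ n → InΔ n τ
  Δ-complete {n} {τ} (in-tile x y s) (0≤x , 0≤y , x+y≤n) =
    in-Δ (≤-unit {0ℤ} {col τ} 0≤x x) (≤-unit {0ℤ} {row τ} 0≤y y) (unit-≤ {+ n} {diag τ} x+y≤n s)

  Δ-sound : ∀ {n τ} p → InΔ n τ → p ∈ᴮ tileBox τ → p ∈Δ n
  Δ-sound p (in-Δ 0≤i 0≤j k<n) (in-box (i≤x , _) (j≤y , _) (_ , s≤k)) =
    ≤-trans (ℤ→ℚ-mono-≤ 0≤i) i≤x , ≤-trans (ℤ→ℚ-mono-≤ 0≤j) j≤y , ≤-trans s≤k (ℤ→ℚ-mono-≤ k<n)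

  below₂ : ∀ {a b} → 0ℚ < a → 0ℚ < b → ∃[ δ ] 0ℚ < δ × δ < a × δ < b
  below₂ {a} {b} 0<a 0<b with ≤-total a b
  ... | inj₁ a≤b = let δ , 0<δ , δ<a = <-dense 0<a in δ , 0<δ , δ<a , <-≤-trans δ<a a≤b
  ... | inj₂ b≤a = let δ , 0<δ , δ<b = <-dense 0<b in δ , 0<δ , <-≤-trans δ<b b≤a , δ<b

  tile : ∀ i j k → i ℤ.+ j ℤ.≤ k → k ℤ.≤ ℤ.suc (i ℤ.+ j) → ∃[ τ ] col τ ≡ i × row τ ≡ j × diag τ ≡ k
  tile i j k i+j≤k k≤1+i+j with i ℤ.+ j ℤ.≟ k
  ... | yes i+j≡k = △ i j , refl , refl , i+j≡k
  ... | no  i+j≢k = ▽ i j , refl , refl , ℤ.≤-antisym (ℤ.i<j⇒suc[i]≤j (ℤ.≤∧≢⇒< i+j≤k i+j≢k)) k≤1+i+j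

  infix 4 _∈[_⟩

  record _∈[_⟩ (x : ℚ) (i : ℤ) : Set where
    constructor _,_
    field
      lower : ℤ→ℚ i ≤ x
      upper : x < ℤ→ℚ (ℤ.suc i)

  ∈floor : ∀ x → x ∈[ floor x ⟩
  ∈floor x = floor-≤ x , <-suc-floor x

  close-unit : ∀ {x i} → x ∈[ i ⟩ → x ∈[ unit i ]
  close-unit (l , h) = l , <⇒≤ h

  ≤-halfOpen : ∀ {l x i} → ℤ→ℚ l ≤ x → x ∈[ i ⟩ → l ℤ.≤ i
  ≤-halfOpen {l} {x} {i} l≤x (_ , h) = <-suc⇒≤ {l} {i} (ℤ→ℚ-cancel-< {l} {ℤ.suc i} (≤-<-trans l≤x h))

  halfOpen-< : ∀ {x i h} → x < ℤ→ℚ h → x ∈[ i ⟩ → ℤ.suc i ℤ.≤ h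
  halfOpen-< {x} {i} {h} x<h (l , _) = ℤ.i<j⇒suc[i]≤j (ℤ→ℚ-cancel-< {i} {h} (≤-<-trans l x<h))

  -- The floor of `x + y` exceeds the sum of the floors of `x` and `y` by 0 or 1; the two cases are
  -- the up- and the down-triangle of the unit square.
  floorTile : ∀ p → ∃[ τ ] proj₁ p ∈[ col τ ⟩ × proj₂ p ∈[ row τ ⟩ × (proj₁ p + proj₂ p) ∈[ diag τ ⟩
  floorTile (x , y) = let τ , c , r , d = tile i j k i+j≤k k≤1+i+j in
    τ , subst (x ∈[_⟩) (sym c) (∈floor x) , subst (y ∈[_⟩) (sym r) (∈floor y) ,
    subst (x + y ∈[_⟩) (sym d) (∈floor (x + y))
    where
    i = floor x
    j = floor y
    k = floor (x + y)
    suc-suc : ∀ i j → ℤ.suc i ℤ.+ ℤ.suc j ≡ ℤ.suc (ℤ.suc (i ℤ.+ j))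
    suc-suc = solve 2 (λ i j → con 1ℤ :+ i :+ (con 1ℤ :+ j) := con 1ℤ :+ (con 1ℤ :+ (i :+ j))) refl
      where open ℤ.+-*-Solver
    i+j≤k : i ℤ.+ j ℤ.≤ k
    i+j≤k = ≤-halfOpen (subst (_≤ x + y) (sym (ℤ→ℚ-+ i j)) (+-mono-≤ (floor-≤ x) (floor-≤ y))) (∈floor (x + y))
    k≤1+i+j : k ℤ.≤ ℤ.suc (i ℤ.+ j)
    k≤1+i+j = <-suc⇒≤ {k} {ℤ.suc (i ℤ.+ j)} (ℤ.suc[i]≤j⇒i<j (halfOpen-<
      (subst (x + y <_) (trans (sym (ℤ→ℚ-+ (ℤ.suc i) (ℤ.suc j))) (cong ℤ→ℚ (suc-suc i j)))
        (+-mono-< (<-suc-floor x) (<-suc-floor y))) (∈floor (x + y))))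

  0<q-p : ∀ {p q} → p < q → 0ℚ < q - p
  0<q-p {p} {q} p<q = subst (_< q - p) (+-inverseʳ p) (+-monoˡ-< (- p) p<q)

  -- Translating along the diagonal leaves the lines x ∈ ℤ, y ∈ ℤ and x + y ∈ ℤ.
  generic-translate : ∀ (p : Point) {ε} → 0ℚ < ε →
    ∃[ δ ] 0ℚ < δ × δ < ε × ∃[ τ ] (proj₁ p + δ , proj₂ p + δ) ∈° τ
  generic-translate (x , y) 0<ε with floorTile (x , y)
  ... | τ , (x≥ , x<) , (y≥ , y<) , (s≥ , s<)
    -- All three forms increase, and the floor tile is half-open in that direction, so a small
    -- enough `δ` stays within it. Since `x + y` moves by 2δ, its gap to the next integer is split
    -- at `β`, and `δ` is kept below both pieces.
    with below₂ (0<q-p x<) (0<q-p y<) | <-dense (0<q-p s<)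
  ... | α , 0<α , α<x , α<y | β , 0<β , β<s
    with below₂ 0<α 0<β
  ... | γ , 0<γ , γ<α , γ<β
    with below₂ 0<γ (0<q-p β<s)
  ... | η , 0<η , η<γ , η<s
    with below₂ 0<ε 0<η
  ... | δ , 0<δ , δ<ε , δ<η = δ , 0<δ , δ<ε , τ , in-tile
    (right {x} x≥ , left {x} (<-trans δ<γ (<-trans γ<α α<x)))
    (right {y} y≥ , left {y} (<-trans δ<γ (<-trans γ<α α<y)))
    ( <-by (+-mono-≤-< s≥ (+-mono-< 0<δ 0<δ))
        (solve 4 (λ x y δ f → x :+ δ :+ (y :+ δ) :- f := x :+ y :+ (δ :+ δ) :- (f :+ (con 0ℚ :+ con 0ℚ)))
          refl x y δ (ℤ→ℚ (diag τ)))
    , <-by (+-mono-< (<-trans δ<γ γ<β) (<-trans δ<η η<s))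
        (solve 5 (λ x y δ β s → s :- (x :+ δ :+ (y :+ δ)) := β :+ (s :- (x :+ y) :- β) :- (δ :+ δ))
          refl x y δ β (ℤ→ℚ (ℤ.suc (diag τ)))))
    where
    open +-*-Solver
    δ<γ = <-trans δ<η η<γ
    right : ∀ {x z} → z ≤ x → z < x + δ
    right {x} {z} z≤x = subst (_< x + δ) (+-identityʳ z) (+-mono-≤-< z≤x 0<δ)
    left : ∀ {x z} → δ < z - x → x + δ < z
    left {x} {z} δ<z-x = <-by δ<z-x (solve 3 (λ x z δ → z :- (x :+ δ) := z :- x :- δ) refl x z δ)

  translate-close : ∀ z {δ ε} → 0ℚ < δ → δ < ε → ∣ z + δ - z ∣ < ε
  translate-close z {δ} {ε} 0<δ δ<ε = subst (_< ε)
    (sym (trans (cong ∣_∣ (solve 2 (λ z δ → z :+ δ :- z := δ) refl z δ)) (0≤p⇒∣p∣≡p {δ} (<⇒≤ 0<δ)))) δ<ε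
    where open +-*-Solver

  -- The point `p` itself may lie on an edge of the lattice. A short generic translate remains in
  -- both cells and lies in an open tile, which both cells must then contain.
  common-tile : ∀ {C D p} → InteriorOf C p → InteriorOf D p → ∃[ τ ] τ ⊑ C × τ ⊑ D
  common-tile {C} {D} {p} (ε , 0<ε , ball) (ε′ , 0<ε′ , ball′) =
    let η , 0<η , η<ε , η<ε′ = below₂ 0<ε 0<ε′
        δ , 0<δ , δ<η , τ , q∈τ = generic-translate p 0<η
        q = proj₁ p + δ , proj₂ p + δ
        close : ∀ z {ε} → η < ε → ∣ z + δ - z ∣ < ε
        close = λ z η<ε → translate-close z 0<δ (<-trans δ<η η<ε)
    in τ ,
       ⊑-complete {τ} {C} {q} q∈τ (ball q (close (proj₁ p) η<ε) (close (proj₂ p) η<ε)) ,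
       ⊑-complete {τ} {D} {q} q∈τ (ball′ q (close (proj₁ p) η<ε′) (close (proj₂ p) η<ε′))

  unit-covered : ∀ m {x} → 0ℚ ≤ x → x ≤ ℕ→ℚ (suc m) → ∃[ i ] 0ℤ ℤ.≤ i × i ℤ.≤ + m × x ∈[ unit i ]
  unit-covered m {x} 0≤x x≤n with x <? ℕ→ℚ (suc m)
  ... | yes x<n = floor x , ≤-halfOpen 0≤x (∈floor x) ,
    <-suc⇒≤ {floor x} {+ m} (ℤ.suc[i]≤j⇒i<j (halfOpen-< x<n (∈floor x))) , close-unit (∈floor x)
  -- At the right end `x` = m + 1 the floor would be one too large; the last unit interval still
  -- contains `x` as its end.
  ... | no  x≮n = + m , +≤+ ℕ.z≤n , ℤ.≤-refl , (≤-trans (ℤ→ℚ-mono-≤ (ℤ.i≤suc[i] (+ m))) (≮⇒≥ x≮n) , x≤n)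

  -- On the side x + y = n, the floor tile would lie outside of Δ.
  Δ-covered : ∀ m {p} → p ∈Δ suc m → ∃[ τ ] InΔ (suc m) τ × p ∈ᴮ tileBox τ
  Δ-covered m {x , y} (0≤x , 0≤y , x+y≤n) with x + y <? ℕ→ℚ (suc m)
  Δ-covered m {x , y} (0≤x , 0≤y , x+y≤n) | yes x+y<n with floorTile (x , y)
  ... | τ , x∈ , y∈ , s∈ = τ ,
    in-Δ (≤-halfOpen 0≤x x∈) (≤-halfOpen 0≤y y∈) (halfOpen-< x+y<n s∈) ,
    in-box (close-unit x∈) (close-unit y∈) (close-unit s∈)
  Δ-covered m {x , y} (0≤x , 0≤y , x+y≤n) | no x+y≮n
    with unit-covered m 0≤x (≤-trans (subst (_≤ x + y) (+-identityʳ x) (+-monoʳ-≤ x 0≤y)) x+y≤n)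
  -- This is the up-triangle of column `i` along the slanted side. There `y` = n - `x`, so the two
  -- bounds on `x` turn into the two bounds on `y`.
  ... | i , 0≤i , i≤m , (l , h) = △ i (+ m ℤ.- i) ,
    in-Δ 0≤i (ℤ.i≤j⇒0≤j-i i≤m) (ℤ.≤-reflexive (cong ℤ.suc i+j≡m)) ,
    in-box (l , h)
      ( ≤-by h (trans (cong₂ _-_ y≡ (ℤ→ℚ-minus (+ m) i)) (trans
          (solve 3 (λ x m i → con 1ℚ :+ m :- x :- (m :- i) := con 1ℚ :+ i :- x) refl x M A)
          (cong (_- x) (sym (ℤ→ℚ-suc i)))))
      , ≤-by l (trans (cong₂ _-_ (trans (ℤ→ℚ-suc (+ m ℤ.- i)) (cong (_+_ 1ℚ) (ℤ→ℚ-minus (+ m) i))) y≡)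
          (solve 3 (λ x m i → con 1ℚ :+ (m :- i) :- (con 1ℚ :+ m :- x) := x :- i) refl x M A)))
      (subst (λ k → x + y ∈[ unit k ]) (sym i+j≡m)
        (≤-trans (ℤ→ℚ-mono-≤ (ℤ.i≤suc[i] (+ m))) (≮⇒≥ x+y≮n) , x+y≤n))
    where
    open +-*-Solver
    M = ℤ→ℚ (+ m)
    A = ℤ→ℚ i
    i+j≡m : i ℤ.+ (+ m ℤ.- i) ≡ + m
    i+j≡m = trans (ℤ.+-comm i (+ m ℤ.- i)) (cancel-shift (+ m) i)
    y≡ : y ≡ 1ℚ + M - x
    y≡ = trans (solve 2 (λ x y → y := x :+ y :- x) refl x y)
      (cong (_- x) (trans (≤-antisym x+y≤n (≮⇒≥ x+y≮n)) (ℤ→ℚ-suc (+ m))))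

  record CellInΔ (n : ℕ) (C : Cell) : Set where
    constructor cell-in-Δ
    field
      0≤x : 0ℤ ℤ.≤ proj₁ (Box.xs (shapeBox (shape C))) ℤ.+ u C
      0≤y : 0ℤ ℤ.≤ proj₁ (Box.ys (shapeBox (shape C))) ℤ.+ v C
      s≤n : proj₂ (Box.ss (shapeBox (shape C))) ℤ.+ (u C ℤ.+ v C) ℤ.≤ + n

  CellInΔ-sound : ∀ {n C} → CellInΔ n C → ∀ p → p ∈C C → p ∈Δ n
  CellInΔ-sound {n} {C} (cell-in-Δ 0≤lx 0≤ly s≤n) (x , y) p∈C with InShape⇒∈ᴮ (shape C) p∈C
  ... | in-box (x≥ , _) (y≥ , _) (_ , s≤) =
    ≤-trans (ℤ→ℚ-mono-≤ 0≤lx) (lower {x} {proj₁ (Box.xs (shapeBox (shape C)))} (u C) x≥) ,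
    ≤-trans (ℤ→ℚ-mono-≤ 0≤ly) (lower {y} {proj₁ (Box.ys (shapeBox (shape C)))} (v C) y≥) ,
    ≤-trans (≤-by s≤ (trans (cong (_- (x + y)) (trans (ℤ→ℚ-+ h (u C ℤ.+ v C)) (cong (_+_ (ℤ→ℚ h)) (ℤ→ℚ-+ (u C) (v C)))))
               (solve 5 (λ x y u v h → h :+ (u :+ v) :- (x :+ y) := h :- (x :- u :+ (y :- v))) refl
                 x y (ℤ→ℚ (u C)) (ℤ→ℚ (v C)) (ℤ→ℚ h))))
            (ℤ→ℚ-mono-≤ s≤n)
    where
    open +-*-Solver
    h = proj₂ (Box.ss (shapeBox (shape C)))
    lower : ∀ {x l} u → ℤ→ℚ l ≤ x - ℤ→ℚ u → ℤ→ℚ (l ℤ.+ u) ≤ x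
    lower {x} {l} u h = ≤-by h (trans (cong (_-_ x) (ℤ→ℚ-+ l u))
      (solve 3 (λ x u l → x :- (l :+ u) := x :- u :- l) refl x (ℤ→ℚ u) (ℤ→ℚ l)))

open Geometry
open import Data.Bool using (true; false; if_then_else_)
open import Data.Nat using (_+_; _*_; _∸_; _≤_; _<_; _<ᵇ_; NonZero)
open import Data.Nat.Divisibility
open import Data.Nat.ListAction using (sum)
open import Data.Nat.ListAction.Properties using (sum-++; sum-↭)
open import Data.Nat.Primality using (prime?; euclidsLemma)
open import Data.Nat.Properties
open import Data.Nat.Solver using (module +-*-Solver)
open import Algebra.Properties.CommutativeSemigroup +-commutativeSemigroup using (interchange)
open import Data.List.Relation.Unary.Unique.DecPropositional _≟ᵀ_ using (unique?)

-- Sums over triangular arrays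

pairs : ℕ → List (ℕ × ℕ)
pairs zero    = []
pairs (suc n) = map (_, 0) (upTo (suc n)) ++ map (map₂ suc) (pairs n)

∈-pairs⁺ : ∀ n {i j} → i + j < n → (i , j) ∈ pairs n
∈-pairs⁺ (suc n) {i} {zero}  i+0≤n = ∈-++⁺ˡ (∈-map⁺ (_, 0) (∈-upTo⁺ (subst (_< suc n) (+-identityʳ i) i+0≤n)))
∈-pairs⁺ (suc n) {i} {suc j} i+j≤n = ∈-++⁺ʳ (map (_, 0) (upTo (suc n)))
  (∈-map⁺ (map₂ suc) (∈-pairs⁺ n (≤-pred (subst (_< suc n) (+-suc i j) i+j≤n))))

∈-pairs⁻ : ∀ n {i j} → (i , j) ∈ pairs n → i + j < n
∈-pairs⁻ (suc n) ∈p with ∈-++⁻ (map (_, 0) (upTo (suc n))) ∈p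
... | inj₁ ∈row with ∈-map⁻ (_, 0) ∈row
...   | i , i∈ , refl = subst (_< suc n) (sym (+-identityʳ i)) (∈-upTo⁻ i∈)
∈-pairs⁻ (suc n) ∈p | inj₂ ∈rest with ∈-map⁻ (map₂ suc) ∈rest
...   | (i , j) , ij∈ , refl = subst (_< suc n) (sym (+-suc i j)) (s≤s (∈-pairs⁻ n ij∈))

pairs-unique : ∀ n → Unique (pairs n)
pairs-unique zero    = []
pairs-unique (suc n) = Unique.++⁺
  (Unique.map⁺ ,-injectiveˡ (Unique.upTo⁺ (suc n)))
  (Unique.map⁺ (λ { refl → refl }) (pairs-unique n))
  λ (∈row , ∈rest) → apart (∈-map⁻ (_, 0) ∈row) (∈-map⁻ (map₂ suc) ∈rest)
  where
  apart : ∀ {p} → ∃[ i ] i ∈ upTo (suc n) × p ≡ (i , 0) → ∃[ q ] q ∈ pairs n × p ≡ map₂ suc q → ⊥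
  apart (_ , _ , refl) (_ , _ , ())

∑ : ℕ → (ℕ → ℕ) → ℕ
∑ zero    f = 0
∑ (suc n) f = f 0 + ∑ n (f ∘ suc)

-- The sum of f i j over all i, j with i + j < n.
∑△ : ℕ → (ℕ → ℕ → ℕ) → ℕ
∑△ zero    f = 0
∑△ (suc n) f = ∑ (suc n) (λ i → f i 0) + ∑△ n (λ i j → f i (suc j))

sum-applyUpTo : ∀ {A : Set} (φ : A → ℕ) (f : ℕ → A) n → sum (map φ (applyUpTo f n)) ≡ ∑ n (φ ∘ f)
sum-applyUpTo φ f zero    = refl
sum-applyUpTo φ f (suc n) = cong (_+_ (φ (f 0))) (sum-applyUpTo φ (f ∘ suc) n)

sum-map-++ : ∀ {A : Set} (φ : A → ℕ) xs ys → sum (map φ (xs ++ ys)) ≡ sum (map φ xs) + sum (map φ ys)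
sum-map-++ φ xs ys = trans (cong sum (map-++ φ xs ys)) (sum-++ (map φ xs) (map φ ys))

sum-pairs : ∀ n (φ : ℕ × ℕ → ℕ) → sum (map φ (pairs n)) ≡ ∑△ n (λ i j → φ (i , j))
sum-pairs zero    φ = refl
sum-pairs (suc n) φ = trans (sum-map-++ φ (map (_, 0) (upTo (suc n))) (map (map₂ suc) (pairs n))) (cong₂ _+_
  (trans (cong sum (sym (map-∘ (upTo (suc n))))) (sum-applyUpTo (φ ∘ (_, 0)) id (suc n)))
  (trans (cong sum (sym (map-∘ (pairs n)))) (sum-pairs n (φ ∘ map₂ suc))))

∑-cong : ∀ n {f g : ℕ → ℕ} → (∀ i → f i ≡ g i) → ∑ n f ≡ ∑ n g
∑-cong zero    eq = refl
∑-cong (suc n) eq = cong₂ _+_ (eq 0) (∑-cong n (eq ∘ suc))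

∑△-cong : ∀ n {f g : ℕ → ℕ → ℕ} → (∀ i j → f i j ≡ g i j) → ∑△ n f ≡ ∑△ n g
∑△-cong zero    eq = refl
∑△-cong (suc n) eq = cong₂ _+_ (∑-cong (suc n) (λ i → eq i 0)) (∑△-cong n (λ i j → eq i (suc j)))

∑-+ : ∀ n f g → ∑ n (λ i → f i + g i) ≡ ∑ n f + ∑ n g
∑-+ zero    f g = refl
∑-+ (suc n) f g = trans (cong (_+_ (f 0 + g 0)) (∑-+ n (f ∘ suc) (g ∘ suc)))
  (interchange (f 0) (g 0) (∑ n (f ∘ suc)) (∑ n (g ∘ suc)))

∑△-+ : ∀ n f g → ∑△ n (λ i j → f i j + g i j) ≡ ∑△ n f + ∑△ n g
∑△-+ zero    f g = refl
∑△-+ (suc n) f g = trans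
  (cong₂ _+_ (∑-+ (suc n) (λ i → f i 0) (λ i → g i 0)) (∑△-+ n (λ i j → f i (suc j)) (λ i j → g i (suc j))))
  (interchange (∑ (suc n) (λ i → f i 0)) _ _ _)

∑-zero : ∀ n {f} → (∀ i → f i ≡ 0) → ∑ n f ≡ 0
∑-zero zero    eq = refl
∑-zero (suc n) eq = cong₂ _+_ (eq 0) (∑-zero n (eq ∘ suc))

∑△-zero : ∀ n {f} → (∀ i j → f i j ≡ 0) → ∑△ n f ≡ 0
∑△-zero zero    eq = refl
∑△-zero (suc n) eq = cong₂ _+_ (∑-zero (suc n) (λ i → eq i 0)) (∑△-zero n (λ i j → eq i (suc j)))

∑-last : ∀ n f → ∑ (suc n) f ≡ ∑ n f + f n
∑-last zero    f = +-identityʳ (f 0)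
∑-last (suc n) f = trans (cong (_+_ (f 0)) (∑-last n (f ∘ suc))) (sym (+-assoc (f 0) _ _))

∑-drop-last : ∀ n f → f n ≡ 0 → ∑ (suc n) f ≡ ∑ n f
∑-drop-last n f fn≡0 = trans (∑-last n f) (trans (cong (_+_ (∑ n f)) fn≡0) (+-identityʳ _))

-- An interior point is a vertex of three up- and three down-triangles; a point inside the
-- bottom side, of two up-triangles and one down-triangle.
∑-vertices : ∀ n (f : ℕ → ℕ → ℕ) → (∀ j → f 0 j ≡ 0) → (∀ i j → i + j ≡ n → f i j ≡ 0) →
             ∑△ n (λ i j → f i j + f (suc i) j + f i (suc j)) ≡
             ∑△ (n ∸ 1) (λ i j → f (suc i) j + f i (suc j) + f (suc i) (suc j)) + ∑ n (λ i → f i 0)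
∑-vertices zero          f left slant = refl
∑-vertices (suc zero)    f left slant
  rewrite left 0 | left 1 | slant 1 0 refl = refl
∑-vertices (suc n@(suc k)) f left slant = begin
  ∑ (suc n) (λ i → f i 0 + f (suc i) 0 + f i 1) + ups
    -- The induction hypothesis concerns the rows from height 1 on, whose bottom row is not a side
    -- of Δ; this is why the statement carries the sum over the bottom row.
    ≡⟨ cong₂ _+_ (∑-+₃ (suc n) (λ i → f i 0) (λ i → f (suc i) 0) (λ i → f i 1))
         (∑-vertices n (λ i j → f i (suc j)) (left ∘ suc)
           (λ i j eq → slant i (suc j) (trans (+-suc i j) (cong suc eq)))) ⟩
  A + ∑ (suc n) (λ i → f (suc i) 0) + ∑ (suc n) (λ i → f i 1) + (downs + B)
    ≡⟨ cong₂ (λ a b → A + a + b + (downs + B))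
         (∑-drop-last n (λ i → f (suc i) 0) (slant (suc n) 0 (+-identityʳ (suc n))))
         (∑-drop-last n (λ i → f i 1) (slant n 1 n+1≡)) ⟩
  A + A′ + B + (downs + B)
    ≡⟨ solve 4 (λ a a′ b d → a :+ a′ :+ b :+ (d :+ b) := a′ :+ b :+ b :+ d :+ a) refl A A′ B downs ⟩
  A′ + B + B + downs + A
    -- One `B` comes from the tops of the lowest up-triangles, the other from the induction
    -- hypothesis. The second is reindexed to give the upper right vertices of the lowest
    -- down-triangles, at no cost because `f` vanishes at both ends of the row.
    ≡⟨ cong (λ b → A′ + B + b + downs + A) B≡ ⟩
  A′ + B + ∑ n (λ i → f (suc i) 1) + downs + A
    ≡⟨ cong (λ r → r + downs + A) (∑-+₃ n (λ i → f (suc i) 0) (λ i → f i 1) (λ i → f (suc i) 1)) ⟨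
  ∑ n (λ i → f (suc i) 0 + f i 1 + f (suc i) 1) + downs + A
    ∎
  where
  open ≡-Reasoning
  open +-*-Solver
  ups = ∑△ n (λ i j → f i (suc j) + f (suc i) (suc j) + f i (suc (suc j)))
  downs = ∑△ k (λ i j → f (suc i) (suc j) + f i (suc (suc j)) + f (suc i) (suc (suc j)))
  A = ∑ (suc n) (λ i → f i 0)
  A′ = ∑ n (λ i → f (suc i) 0)
  B = ∑ n (λ i → f i 1)
  n+1≡ : n + 1 ≡ suc n
  n+1≡ = +-comm n 1
  B≡ : B ≡ ∑ n (λ i → f (suc i) 1)
  B≡ = trans (cong (_+ ∑ k (λ i → f (suc i) 1)) (left 1))
    (sym (∑-drop-last k (λ i → f (suc i) 1) (slant n 1 n+1≡)))
  ∑-+₃ : ∀ n f g h → ∑ n (λ i → f i + g i + h i) ≡ ∑ n f + ∑ n g + ∑ n h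
  ∑-+₃ n f g h = trans (∑-+ n (λ i → f i + g i) h) (cong (_+ ∑ n h) (∑-+ n f g))

δ : ℕ → ℕ → ℕ
δ zero    zero    = 1
δ zero    (suc b) = 0
δ (suc a) zero    = 0
δ (suc a) (suc b) = δ a b

δ-refl : ∀ a → δ a a ≡ 1
δ-refl zero    = refl
δ-refl (suc a) = δ-refl a

∑-δ : ∀ {a} n → a < n → ∑ n (δ a) ≡ 1
∑-δ {zero}  (suc n) _         = cong suc (∑-zero n (λ _ → refl))
∑-δ {suc a} (suc n) (s≤s a<n) = ∑-δ n a<n

∑△-δ : ∀ n a b → a + b < n → ∑△ n (λ i j → δ a i * δ b j) ≡ 1
∑△-δ (suc n) a zero    a+0≤n = cong₂ _+_
  (trans (∑-cong (suc n) (λ i → *-identityʳ (δ a i))) (∑-δ (suc n) (subst (_< suc n) (+-identityʳ a) a+0≤n)))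
  (∑△-zero n (λ i j → *-zeroʳ (δ a i)))
∑△-δ (suc n) a (suc b) a+b≤n = cong₂ _+_
  (∑-zero (suc n) (λ i → *-zeroʳ (δ a i)))
  (∑△-δ n a b (≤-pred (subst (_< suc n) (+-suc a b) a+b≤n)))

∑-one : ∀ n → ∑ n (λ _ → 1) ≡ n
∑-one zero    = refl
∑-one (suc n) = cong suc (∑-one n)

∑△-one-suc : ∀ m → ∑△ (suc m) (λ _ _ → 1) ≡ suc m + ∑△ m (λ _ _ → 1)
∑△-one-suc m = cong (_+ ∑△ m (λ _ _ → 1)) (∑-one (suc m))

2*∑△-one : ∀ m → 2 * ∑△ m (λ _ _ → 1) ≡ m * suc m
2*∑△-one zero    = refl
2*∑△-one (suc m) = begin
  2 * ∑△ (suc m) (λ _ _ → 1)       ≡⟨ cong (2 *_) (∑△-one-suc m) ⟩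
  2 * (suc m + ∑△ m (λ _ _ → 1))   ≡⟨ *-distribˡ-+ 2 (suc m) _ ⟩
  2 * suc m + 2 * ∑△ m (λ _ _ → 1) ≡⟨ cong (_+_ (2 * suc m)) (2*∑△-one m) ⟩
  2 * suc m + m * suc m            ≡⟨ solve 1 (λ m → con 2 :* (con 1 :+ m) :+ m :* (con 1 :+ m)
      := (con 1 :+ m) :* (con 2 :+ m)) refl m ⟩
  suc m * suc (suc m)              ∎
  where
  open ≡-Reasoning
  open +-*-Solver

-- Corners are counted with multiplicity, so that the total is 3 even for `n` = 0, where they
-- coincide. For Δ of side m + 1, `corner m` marks the up-triangles in the corners and
-- `corner (suc m)` the corner points.
corner : ℕ → ℕ → ℕ → ℕ
corner n i j = δ 0 i * δ 0 j + δ n i * δ 0 j + δ 0 i * δ n j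

∑△-corner : ∀ n → ∑△ (suc n) (corner n) ≡ 3
∑△-corner n = trans (∑△-+ (suc n) (λ i j → δ 0 i * δ 0 j + δ n i * δ 0 j) (λ i j → δ 0 i * δ n j))
  (cong₂ _+_ (trans (∑△-+ (suc n) (λ i j → δ 0 i * δ 0 j) (λ i j → δ n i * δ 0 j))
               (cong₂ _+_ (∑△-δ (suc n) 0 0 (s≤s z≤n)) (∑△-δ (suc n) n 0 (s≤s (≤-reflexive (+-identityʳ n))))))
             (∑△-δ (suc n) 0 n ≤-refl))

-- The lower bound

up down : ℕ × ℕ → Tile
up   (i , j) = △ (+ i) (+ j)
down (i , j) = ▽ (+ i) (+ j)

-- The side of Δ is suc m.
ΔTiles : ℕ → List Tile
ΔTiles m = map up (pairs (suc m)) ++ map down (pairs m)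

InΔ⇒∈ΔTiles : ∀ m {τ} → InΔ (suc m) τ → τ ∈ ΔTiles m
InΔ⇒∈ΔTiles m {△ (+ i) (+ j)} (in-Δ _ _ (+≤+ i+j<n)) = ∈-++⁺ˡ (∈-map⁺ up (∈-pairs⁺ (suc m) i+j<n))
InΔ⇒∈ΔTiles m {▽ (+ i) (+ j)} (in-Δ _ _ (+≤+ (s≤s i+j<m))) =
  ∈-++⁺ʳ (map up (pairs (suc m))) (∈-map⁺ down (∈-pairs⁺ m i+j<m))

∈ΔTiles⇒InΔ : ∀ m {τ} → τ ∈ ΔTiles m → InΔ (suc m) τ
∈ΔTiles⇒InΔ m τ∈ with ∈-++⁻ (map up (pairs (suc m))) τ∈
... | inj₁ ∈ups with ∈-map⁻ up ∈ups
...   | _ , ij∈ , refl = in-Δ (+≤+ z≤n) (+≤+ z≤n) (+≤+ (∈-pairs⁻ (suc m) ij∈))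
∈ΔTiles⇒InΔ m τ∈ | inj₂ ∈downs with ∈-map⁻ down ∈downs
...   | _ , ij∈ , refl = in-Δ (+≤+ z≤n) (+≤+ z≤n) (+≤+ (s≤s (∈-pairs⁻ m ij∈)))

ΔTiles-unique : ∀ m → Unique (ΔTiles m)
ΔTiles-unique m = Unique.++⁺ (Unique.map⁺ (λ { refl → refl }) (pairs-unique (suc m)))
  (Unique.map⁺ (λ { refl → refl }) (pairs-unique m)) apart
  where
  apart : Disjoint (map up (pairs (suc m))) (map down (pairs m))
  apart (∈ups , ∈downs) with ∈-map⁻ up ∈ups | ∈-map⁻ down ∈downs
  ... | _ , _ , refl | _ , _ , ()

tiles-unique : ∀ C → Unique (tiles C)
tiles-unique C = Unique.map⁺ shift-injective (tilesOf-unique (shape C))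
  where
  shift-injective : ∀ {σ τ} → shift (u C) (v C) σ ≡ shift (u C) (v C) τ → σ ≡ τ
  shift-injective {σ} {τ} eq = trans (sym (unshift-shift (u C) (v C) σ))
    (trans (cong (unshift (u C) (v C)) eq) (unshift-shift (u C) (v C) τ))
  tilesOf-unique : ∀ s → Unique (tilesOf s)
  tilesOf-unique tri   = from-yes (unique? (tilesOf tri))
  tilesOf-unique par₁₂ = from-yes (unique? (tilesOf par₁₂))
  tilesOf-unique par₁₃ = from-yes (unique? (tilesOf par₁₃))
  tilesOf-unique par₂₃ = from-yes (unique? (tilesOf par₂₃))
  tilesOf-unique hex   = from-yes (unique? (tilesOf hex))

-- Duplicate-free lists with the same members are permutations of each other. The centroids are the
-- test points at which `covers`, `inside` and `disjoint` are invoked.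
subdivision⇒tiling : ∀ {m cells} → IsSemiuniformSubdivision (suc m) cells → concatMap tiles cells ↭ ΔTiles m
subdivision⇒tiling {m} {cells} S = ∼bag⇒↭ (unique∧set⇒bag cells-unique (ΔTiles-unique m) (mk⇔ to from))
  where
  open IsSemiuniformSubdivision S
  cells-unique : Unique (concatMap tiles cells)
  cells-unique = Unique.concat⁺ (All.map⁺ (All.universal tiles-unique cells))
    (AllPairs.map⁺ (AllPairs.map (λ {C} {D} apart {τ} (τ∈C , τ∈D) →
      apart (centroid τ)
        (centroid-interior {τ} {C} (∈tiles⇒⊑ {C = C} τ∈C) ,
         centroid-interior {τ} {D} (∈tiles⇒⊑ {C = D} τ∈D))) disjoint))
  to : ∀ {τ} → τ ∈ concatMap tiles cells → τ ∈ ΔTiles m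
  to {τ} τ∈ with find (∈-concatMap⁻ tiles {xs = cells} τ∈)
  ... | C , C∈ , τ∈C = InΔ⇒∈ΔTiles m (Δ-complete {suc m} (centroid∈° τ)
    (All.lookup inside C∈ (centroid τ) (⊑-sound {τ} {C} (∈tiles⇒⊑ {C = C} τ∈C) (∈°⇒∈ᴮ τ (centroid∈° τ)))))
  from : ∀ {τ} → τ ∈ ΔTiles m → τ ∈ concatMap tiles cells
  from {τ} τ∈ = ∈-concatMap⁺ tiles
    (Any.map (λ {C} p∈C → ⊑⇒∈tiles {C = C} (⊑-complete {τ} {C} {centroid τ} (centroid∈° τ) p∈C))
    (covers (centroid τ) (Δ-sound (centroid τ) (∈ΔTiles⇒InΔ m τ∈) (∈°⇒∈ᴮ τ (centroid∈° τ)))))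

-- Counting cells by weights on tiles

sum-concatMap : ∀ {A B : Set} (φ : B → ℕ) (f : A → List B) xs →
                sum (map φ (concatMap f xs)) ≡ sum (map (sum ∘ map φ ∘ f) xs)
sum-concatMap φ f []       = refl
sum-concatMap φ f (x ∷ xs) = trans (sum-map-++ φ (f x) (concatMap f xs))
  (cong (_+_ (sum (map φ (f x)))) (sum-concatMap φ f xs))

isTri isHex : Shape → ℕ
isTri tri = 1
isTri _   = 0
isHex hex = 1
isHex _   = 0

#triangles #hexagons : List Cell → ℕ
#triangles = sum ∘ map (isTri ∘ shape)
#hexagons  = sum ∘ map (isHex ∘ shape)

#parallelograms-sum : ∀ cells → #parallelograms cells ≡ sum (map (isPar? ∘ shape) cells)
#parallelograms-sum []       = refl
#parallelograms-sum (C ∷ cs) = cong (_+_ (isPar? (shape C))) (#parallelograms-sum cs)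

sum-map-+ : ∀ {A : Set} (f g : A → ℕ) xs → sum (map (λ x → f x + g x) xs) ≡ sum (map f xs) + sum (map g xs)
sum-map-+ f g []       = refl
sum-map-+ f g (x ∷ xs) = trans (cong (_+_ (f x + g x)) (sum-map-+ f g xs)) (interchange (f x) (g x) _ _)

sum-map-* : ∀ {A : Set} k (f : A → ℕ) xs → sum (map (λ x → k * f x) xs) ≡ k * sum (map f xs)
sum-map-* k f []       = sym (*-zeroʳ k)
sum-map-* k f (x ∷ xs) = trans (cong (_+_ (k * f x)) (sum-map-* k f xs)) (sym (*-distribˡ-+ k (f x) _))

sum-mono : ∀ {A : Set} {f g : A → ℕ} {xs} → All (λ x → f x ≤ g x) xs → sum (map f xs) ≤ sum (map g xs)
sum-mono []       = z≤n
sum-mono (h ∷ hs) = +-mono-≤ h (sum-mono hs)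

sum-ΔTiles : ∀ m (φ : Tile → ℕ) → sum (map φ (ΔTiles m)) ≡
             ∑△ (suc m) (λ i j → φ (△ (+ i) (+ j))) + ∑△ m (λ i j → φ (▽ (+ i) (+ j)))
sum-ΔTiles m φ = trans (sum-map-++ φ (map up (pairs (suc m))) (map down (pairs m))) (cong₂ _+_
  (trans (cong sum (sym (map-∘ (pairs (suc m))))) (sum-pairs (suc m) (φ ∘ up)))
  (trans (cong sum (sym (map-∘ (pairs m)))) (sum-pairs m (φ ∘ down))))

weight : (Tile → ℕ) → Cell → ℕ
weight φ C = sum (map φ (tiles C))

module Tiling (m : ℕ) (cells : List Cell) (tiling : concatMap tiles cells ↭ ΔTiles m) where

  -- Double counting: a weight on tiles is summed cell by cell and over all of Δ. The counts of
  -- tiles of each kind and the surplus inequality are all instances.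
  sum-weight : ∀ φ → sum (map (weight φ) cells) ≡
               ∑△ (suc m) (λ i j → φ (△ (+ i) (+ j))) + ∑△ m (λ i j → φ (▽ (+ i) (+ j)))
  sum-weight φ = trans (sym (sum-concatMap φ tiles cells)) (trans (sum-↭ (map⁺ φ tiling)) (sum-ΔTiles m φ))

  private
    isUp isDown : Tile → ℕ
    isUp   (△ _ _) = 1
    isUp   (▽ _ _) = 0
    isDown (△ _ _) = 0
    isDown (▽ _ _) = 1

    weight-isDown : ∀ C → weight isDown C ≡ isPar? (shape C) + 3 * isHex (shape C)
    weight-isDown (cell tri   _ _) = refl
    weight-isDown (cell par₁₂ _ _) = refl
    weight-isDown (cell par₁₃ _ _) = refl
    weight-isDown (cell par₂₃ _ _) = refl
    weight-isDown (cell hex   _ _) = refl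

    weight-isUp : ∀ C → weight isUp C ≡ isTri (shape C) + weight isDown C
    weight-isUp (cell tri   _ _) = refl
    weight-isUp (cell par₁₂ _ _) = refl
    weight-isUp (cell par₁₃ _ _) = refl
    weight-isUp (cell par₂₃ _ _) = refl
    weight-isUp (cell hex   _ _) = refl

    #down : sum (map (weight isDown) cells) ≡ ∑△ m (λ _ _ → 1)
    #down = trans (sum-weight isDown) (cong (_+ ∑△ m (λ _ _ → 1)) (∑△-zero (suc m) (λ _ _ → refl)))

  pars+3hexes : #parallelograms cells + 3 * #hexagons cells ≡ ∑△ m (λ _ _ → 1)
  pars+3hexes = begin
    #parallelograms cells + 3 * #hexagons cells
      ≡⟨ cong₂ _+_ (#parallelograms-sum cells) (sym (sum-map-* 3 (isHex ∘ shape) cells)) ⟩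
    sum (map (isPar? ∘ shape) cells) + sum (map (λ C → 3 * isHex (shape C)) cells)
      ≡⟨ sum-map-+ (isPar? ∘ shape) (λ C → 3 * isHex (shape C)) cells ⟨
    sum (map (λ C → isPar? (shape C) + 3 * isHex (shape C)) cells)
      ≡⟨ cong sum (map-cong (λ C → sym (weight-isDown C)) cells) ⟩
    sum (map (weight isDown) cells)
      ≡⟨ #down ⟩
    ∑△ m (λ _ _ → 1)
      ∎
    where open ≡-Reasoning

  -- Parallelograms and hexagons have as many up- as down-tiles, so the triangles make up the whole
  -- excess of up-tiles in Δ.
  #triangles≡n : #triangles cells ≡ suc m
  #triangles≡n = +-cancelʳ-≡ (∑△ m (λ _ _ → 1)) (#triangles cells) (suc m) (begin
    #triangles cells + ∑△ m (λ _ _ → 1)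
      ≡⟨ cong (_+_ (#triangles cells)) #down ⟨
    #triangles cells + sum (map (weight isDown) cells)
      ≡⟨ sum-map-+ (isTri ∘ shape) (weight isDown) cells ⟨
    sum (map (λ C → isTri (shape C) + weight isDown C) cells)
      ≡⟨ cong sum (map-cong (λ C → sym (weight-isUp C)) cells) ⟩
    sum (map (weight isUp) cells)
      ≡⟨ sum-weight isUp ⟩
    ∑△ (suc m) (λ _ _ → 1) + ∑△ m (λ _ _ → 0)
      ≡⟨ cong₂ _+_ (∑△-one-suc m) (∑△-zero m (λ _ _ → refl)) ⟩
    suc m + ∑△ m (λ _ _ → 1) + 0
      ≡⟨ +-identityʳ _ ⟩
    suc m + ∑△ m (λ _ _ → 1)
      ∎)
    where open ≡-Reasoning

-- The surplus inequality

𝟙[_<_] : ℕ → ℕ → ℕ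
𝟙[ a < b ] = if a <ᵇ b then 1 else 0

𝟙≤1 : ∀ a b → 𝟙[ a < b ] ≤ 1
𝟙≤1 a b with a <ᵇ b
... | true  = ≤-refl
... | false = z≤n

𝟙-yes : ∀ {a b} → a < b → 𝟙[ a < b ] ≡ 1
𝟙-yes {a} {b} a<b with a <ᵇ b | <⇒<ᵇ a<b
... | true | _ = refl

𝟙-no : ∀ {a b} → ¬ a < b → 𝟙[ a < b ] ≡ 0
𝟙-no {a} {b} a≮b with a <ᵇ b | <ᵇ⇒< a b
... | true  | a<b = contradiction (a<b _) a≮b
... | false | _   = refl

-- Interior points and corner tiles have no negative coordinates, so 0 is the right default. With
-- it, the inequalities for parallelograms and hexagons hold at arbitrary integer positions.
extend : (ℕ → ℕ → ℕ) → ℤ → ℤ → ℕ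
extend f (+ i) (+ j) = f i j
extend f _     _     = 0

extend-≤ : ∀ {f b} → (∀ i j → f i j ≤ b) → ∀ i j → extend f i j ≤ b
extend-≤ f≤b (+ i)     (+ j)     = f≤b i j
extend-≤ f≤b (+ i)     -[1+ j ]  = z≤n
extend-≤ f≤b -[1+ i ]  _         = z≤n

-- The pattern of a parallelogram: `a` collects the two vertices shared by its tiles and the tile
-- count, `d` is the acute vertex of the down-tile, paid for by the 1 that the parallelogram
-- contributes, and `c` is what the up-tile has left over.
absorb : ∀ {x y} d a c → d ≤ 1 → x ≡ d + a → y ≡ 1 + a + c → x ≤ y
absorb d a c d≤1 refl refl = ≤-trans (+-monoˡ-≤ a d≤1) (m≤m+n (1 + a) c)

module LowerBound (m : ℕ) (cells : List Cell) (tiling : concatMap tiles cells ↭ ΔTiles m) where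
  open +-*-Solver
  open Tiling m cells tiling

  interior : ℕ → ℕ → ℕ
  interior (suc i) (suc j) = 𝟙[ suc (i + j) < m ]
  interior _       _       = 0

  interior≤1 : ∀ i j → interior i j ≤ 1
  interior≤1 zero    _       = z≤n
  interior≤1 (suc _) zero    = z≤n
  interior≤1 (suc i) (suc j) = 𝟙≤1 (suc (i + j)) m

  interior-slant : ∀ i j → i + j ≡ suc m → interior i j ≡ 0
  interior-slant zero    _       _  = refl
  interior-slant (suc _) zero    _  = refl
  interior-slant (suc i) (suc j) eq = 𝟙-no (<-irrefl (trans (sym (+-suc i j)) (suc-injective eq)))

  interior-bottom : ∀ i → interior i 0 ≡ 0
  interior-bottom zero    = refl
  interior-bottom (suc _) = refl

  -- I marks the interior points of Δ, K the up-triangles in its corners.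
  I K : ℤ → ℤ → ℕ
  I = extend interior
  K = extend (corner m)

  I≤1 : ∀ i j → I i j ≤ 1
  I≤1 = extend-≤ interior≤1

  -- The difference `supply` - `demand` is, for an up-tile, its interior vertices plus the corner
  -- term minus 1, and for a down-tile 1 minus its interior vertices. Over all of Δ the interior
  -- vertices cancel, leaving 3 - n.
  supply demand : Tile → ℕ
  supply (△ i j) = I i j + I (ℤ.suc i) j + I i (ℤ.suc j) + K i j
  supply (▽ i j) = 1
  demand (△ i j) = 1
  demand (▽ i j) = I (ℤ.suc i) j + I i (ℤ.suc j) + I (ℤ.suc i) (ℤ.suc j)

  -- In a corner the term `K` suffices. Elsewhere an interior vertex is (i + 1, j) on the left side,
  -- (i, j + 1) on the bottom side, and (i, j) otherwise.
  1≤supply : ∀ {i j} → InΔ (suc m) (△ i j) → 1 ≤ supply (△ i j)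
  1≤supply {+ zero} {+ zero} _ = s≤s z≤n
  1≤supply {+ zero} {+ suc j} (in-Δ _ _ (+≤+ (s≤s j<m))) with m≤n⇒m<n∨m≡n j<m
  ... | inj₁ 1+j<m rewrite 𝟙-yes 1+j<m = s≤s z≤n
  ... | inj₂ refl  rewrite δ-refl j = m≤n+m 1 _
  1≤supply {+ suc i} {+ zero} (in-Δ _ _ (+≤+ (s≤s i<m))) with m≤n⇒m<n∨m≡n i<m
  ... | inj₁ 1+i<m rewrite 𝟙-yes 1+i<m = s≤s z≤n
  ... | inj₂ refl rewrite +-identityʳ i | δ-refl i = m≤n+m 1 _
  1≤supply {+ suc i} {+ suc j} (in-Δ _ _ (+≤+ (s≤s i+j<m)))
    rewrite 𝟙-yes (subst (_≤ m) (cong suc (+-suc i j)) i+j<m) = s≤s z≤n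

  demand≤supply : ∀ C → All (InΔ (suc m)) (tiles C) → weight demand C ≤ weight supply C + isPar? (shape C)
  demand≤supply (cell tri u v) (τ∈Δ ∷ []) = ≤-trans (1≤supply τ∈Δ) (≤-trans (m≤m+n _ 0) (m≤m+n _ 0))
  demand≤supply (cell par₁₂ u v) _
    rewrite ℤ.+-identityˡ v | ℤ.suc-pred u | ℤ.suc-pred v
    = absorb (I u q) (1 + I p v + I u v) (I p v⁺ + K p v) (I≤1 u q)
        (solve 3 (λ a b d → con 1 :+ (d :+ a :+ b :+ con 0)
            := d :+ (con 1 :+ a :+ b)) refl (I p v) (I u v) (I u q))
        (solve 4 (λ a b c k → a :+ b :+ c :+ k :+ con 1 :+ con 1
            := con 1 :+ (con 1 :+ a :+ b) :+ (c :+ k)) refl (I p v) (I u v) (I p v⁺) (K p v))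
    where
    p = ℤ.pred u
    q = ℤ.pred v
    v⁺ = ℤ.suc v
  demand≤supply (cell par₁₃ u v) _
    rewrite ℤ.+-identityˡ u | ℤ.+-identityˡ v | ℤ.suc-pred u
    = absorb (I p v⁺) (1 + I u v + I u v⁺) (I u⁺ v + K u v) (I≤1 p v⁺)
        (solve 3 (λ a b d → con 1 :+ (a :+ d :+ b :+ con 0)
            := d :+ (con 1 :+ a :+ b)) refl (I u v) (I u v⁺) (I p v⁺))
        (solve 4 (λ a b c k → a :+ c :+ b :+ k :+ con 1 :+ con 1
            := con 1 :+ (con 1 :+ a :+ b) :+ (c :+ k)) refl (I u v) (I u v⁺) (I u⁺ v) (K u v))
    where
    p = ℤ.pred u
    u⁺ = ℤ.suc u
    v⁺ = ℤ.suc v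
  demand≤supply (cell par₂₃ u v) _
    rewrite ℤ.+-identityˡ u | ℤ.suc-pred v
    = absorb (I u⁺ v) (1 + I u⁺ q + I u v) (I u q + K u q) (I≤1 u⁺ v)
        (solve 3 (λ a b d → con 1 :+ (a :+ b :+ d :+ con 0)
            := d :+ (con 1 :+ a :+ b)) refl (I u⁺ q) (I u v) (I u⁺ v))
        (solve 4 (λ a b c k → c :+ a :+ b :+ k :+ con 1 :+ con 1
            := con 1 :+ (con 1 :+ a :+ b) :+ (c :+ k)) refl (I u⁺ q) (I u v) (I u q) (K u q))
    where
    q = ℤ.pred v
    u⁺ = ℤ.suc u
  demand≤supply (cell hex u v) _
    rewrite ℤ.+-identityˡ u | ℤ.+-identityˡ v | ℤ.suc-pred u | ℤ.suc-pred v
    -- Equality holds once the corner terms `k`, `l`, `n` are added to the demand: the centre `c` is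
    -- a vertex of three tiles of each kind, every other vertex of one tile of each kind.
    = m+n≤o⇒m≤o _ (≤-reflexive (solve 10
        (λ a b c d e f g k l n →
          con 3 :+ (a :+ b :+ c :+ (c :+ d :+ e :+ (f :+ c :+ g :+ con 0))) :+ (k :+ l :+ n) :=
          b :+ c :+ d :+ k :+ (a :+ f :+ c :+ l :+ (c :+ g :+ e :+ n :+ con 3)) :+ con 0)
        refl (I u q) (I p v) (I u v) (I p v⁺) (I u v⁺) (I u⁺ q) (I u⁺ v) (K p v) (K u q) (K u v)))
    where
    p = ℤ.pred u
    q = ℤ.pred v
    u⁺ = ℤ.suc u
    v⁺ = ℤ.suc v

  cells-InΔ : All (λ C → All (InΔ (suc m)) (tiles C)) cells
  cells-InΔ = All.tabulate λ C∈ → All.tabulate λ τ∈ →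
    ∈ΔTiles⇒InΔ m (∈-resp-↭ tiling (∈-concatMap⁺ tiles (lose C∈ τ∈)))

  n≤3+#parallelograms : suc m ≤ 3 + #parallelograms cells
  n≤3+#parallelograms = +-cancelʳ-≤ (D + E) (suc m) (3 + P) (begin
    suc m + (D + E)
      ≡⟨ +-assoc (suc m) D E ⟨
    suc m + D + E
      ≡⟨ cong (_+ E) (∑△-one-suc m) ⟨
    ∑△ (suc m) (λ _ _ → 1) + E
      ≡⟨ sum-weight demand ⟨
    sum (map (weight demand) cells)
      ≤⟨ sum-mono (All.map (λ {C} → demand≤supply C) cells-InΔ) ⟩
    sum (map (λ C → weight supply C + isPar? (shape C)) cells)
      ≡⟨ sum-map-+ (weight supply) (isPar? ∘ shape) cells ⟩
    sum (map (weight supply) cells) + sum (map (isPar? ∘ shape) cells)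
      ≡⟨ cong₂ _+_ (sum-weight supply) (sym (#parallelograms-sum cells)) ⟩
    ∑△ (suc m) (λ i j → vertices i j + corner m i j) + D + P
      ≡⟨ cong (λ s → s + D + P) (∑△-+ (suc m) vertices (corner m)) ⟩
    ∑△ (suc m) vertices + ∑△ (suc m) (corner m) + D + P
      ≡⟨ cong₂ (λ s t → s + t + D + P) vertices≡E (∑△-corner m) ⟩
    E + 3 + D + P
      ≡⟨ solve 3 (λ e d p → e :+ con 3 :+ d :+ p := con 3 :+ p :+ (d :+ e)) refl E D P ⟩
    3 + P + (D + E)
      ∎)
    where
    open ≤-Reasoning
    P = #parallelograms cells
    D = ∑△ m (λ _ _ → 1)
    -- `E` counts incidences of interior points with down-tiles and, by `vertices≡E`, equally those
    -- with up-tiles; hence it cancels.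
    E = ∑△ m (λ i j → interior (suc i) j + interior i (suc j) + interior (suc i) (suc j))
    vertices : ℕ → ℕ → ℕ
    vertices i j = interior i j + interior (suc i) j + interior i (suc j)
    vertices≡E : ∑△ (suc m) vertices ≡ E
    vertices≡E = trans (∑-vertices (suc m) interior (λ _ → refl) interior-slant)
      (trans (cong (_+_ E) (∑-zero (suc m) interior-bottom)) (+-identityʳ E))

-- The extremal subdivisions

-- The subscript is the excess of `a + 2 b` over its value at (i, j). The three vertices of a tile
-- have consecutive subscripts, hence exactly one of them has a value divisible by 3.
data Vertex : ℕ → ℕ → Tile → Set where
  △₀ : ∀ {i j} → Vertex i j (△ (+ i) (+ j))
  △₁ : ∀ {i j} → Vertex (suc i) j (△ (+ i) (+ j))
  △₂ : ∀ {i j} → Vertex i (suc j) (△ (+ i) (+ j))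
  ▽₁ : ∀ {i j} → Vertex (suc i) j (▽ (+ i) (+ j))
  ▽₂ : ∀ {i j} → Vertex i (suc j) (▽ (+ i) (+ j))
  ▽₃ : ∀ {i j} → Vertex (suc i) (suc j) (▽ (+ i) (+ j))

cell⁺ : Shape → ℕ → ℕ → Cell
cell⁺ s a b = cell s (+ a) (+ b)

-- Dissects the union of those tiles around (a , b) that lie in Δ of side suc m.
star : ℕ → ℕ → ℕ → List Cell
star m zero    zero    = cell⁺ tri 0 0 ∷ []
star m (suc a) zero with a ≟ m
... | yes _ = cell⁺ tri a 0 ∷ []
... | no  _ = cell⁺ tri a 0 ∷ cell⁺ par₁₃ (suc a) 0 ∷ []
star m zero (suc b) with b ≟ m
... | yes _ = cell⁺ tri 0 b ∷ []
... | no  _ = cell⁺ tri 0 b ∷ cell⁺ par₁₂ 1 (suc b) ∷ []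
star m (suc a) (suc b) with a + suc b ≟ m
... | yes _ = cell⁺ tri (suc a) b ∷ cell⁺ par₁₂ (suc a) (suc b) ∷ []
... | no  _ = cell⁺ hex (suc a) (suc b) ∷ []

star-vertex : ∀ m a b → All (λ C → All (Vertex a b) (tiles C)) (star m a b)
star-vertex m zero    zero    = (△₀ ∷ []) ∷ []
star-vertex m (suc a) zero with a ≟ m
... | yes _ = (△₁ ∷ []) ∷ []
... | no  _ = (△₁ ∷ []) ∷ (△₀ ∷ ▽₁ ∷ []) ∷ []
star-vertex m zero (suc b) with b ≟ m
... | yes _ = (△₂ ∷ []) ∷ []
... | no  _ = (△₂ ∷ []) ∷ (△₀ ∷ ▽₂ ∷ []) ∷ []
star-vertex m (suc a) (suc b) with a + suc b ≟ m
... | yes _ = (△₂ ∷ []) ∷ (△₁ ∷ ▽₃ ∷ []) ∷ []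
... | no  _ = (△₁ ∷ △₂ ∷ △₀ ∷ ▽₃ ∷ ▽₁ ∷ ▽₂ ∷ []) ∷ []

star-inside : ∀ m a b → a + b ≤ suc m → All (CellInΔ (suc m)) (star m a b)
star-inside m zero    zero    _ = cell-in-Δ (+≤+ z≤n) (+≤+ z≤n) (+≤+ (s≤s z≤n)) ∷ []
star-inside m (suc a) zero (s≤s a≤m) with a ≟ m
... | yes _   = cell-in-Δ (+≤+ z≤n) (+≤+ z≤n) (+≤+ (s≤s a≤m)) ∷ []
... | no  a≢m = cell-in-Δ (+≤+ z≤n) (+≤+ z≤n) (+≤+ (s≤s a≤m)) ∷
                cell-in-Δ (+≤+ z≤n) (+≤+ z≤n) (+≤+ (s≤s (≤∧≢⇒< a≤m (a≢m ∘ trans (sym (+-identityʳ a)))))) ∷ []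
star-inside m zero (suc b) (s≤s b≤m) with b ≟ m
... | yes _   = cell-in-Δ (+≤+ z≤n) (+≤+ z≤n) (+≤+ (s≤s b≤m)) ∷ []
... | no  b≢m = cell-in-Δ (+≤+ z≤n) (+≤+ z≤n) (+≤+ (s≤s b≤m)) ∷
                cell-in-Δ (+≤+ z≤n) (+≤+ z≤n) (+≤+ (s≤s (≤∧≢⇒< b≤m b≢m))) ∷ []
star-inside m (suc a) (suc b) (s≤s a+b≤m) with a + suc b ≟ m
... | yes _   = cell-in-Δ (+≤+ z≤n) (+≤+ z≤n) (+≤+ (s≤s (subst (_≤ m) (+-suc a b) a+b≤m))) ∷
                cell-in-Δ (+≤+ z≤n) (+≤+ z≤n) (+≤+ (s≤s a+b≤m)) ∷ []
... | no  a+b≢m = cell-in-Δ (+≤+ z≤n) (+≤+ z≤n) (+≤+ (s≤s (≤∧≢⇒< a+b≤m a+b≢m))) ∷ []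

star-disjoint : ∀ m a b → AllPairs (λ C D → Disjoint (tiles C) (tiles D)) (star m a b)
star-disjoint m zero    zero    = [] ∷ []
star-disjoint m (suc a) zero with a ≟ m
... | yes _ = [] ∷ []
... | no  _ = ((λ { (here refl , here ()) ; (here refl , there (here ())) }) ∷ []) ∷ [] ∷ []
star-disjoint m zero (suc b) with b ≟ m
... | yes _ = [] ∷ []
... | no  _ = ((λ { (here refl , here ()) ; (here refl , there (here ())) }) ∷ []) ∷ [] ∷ []
star-disjoint m (suc a) (suc b) with a + suc b ≟ m
... | yes _ = ((λ { (here refl , here ()) ; (here refl , there (here ())) }) ∷ []) ∷ [] ∷ []
... | no  _ = [] ∷ []

star-covers : ∀ m {a b τ} → Vertex a b τ → InΔ (suc m) τ → Any (λ C → τ ∈ tiles C) (star m a b)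
star-covers m {zero} {zero} △₀ _ = here (here refl)
star-covers m {suc a} {zero} △₀ (in-Δ _ _ (+≤+ (s≤s a<m))) with a ≟ m
... | yes refl = contradiction (subst (_≤ a) (cong suc (+-identityʳ a)) a<m) (<-irrefl refl)
... | no  _    = there (here (here refl))
star-covers m {zero} {suc b} △₀ (in-Δ _ _ (+≤+ (s≤s b<m))) with b ≟ m
... | yes refl = contradiction b<m (<-irrefl refl)
... | no  _    = there (here (here refl))
star-covers m {suc a} {suc b} △₀ (in-Δ _ _ (+≤+ (s≤s a+b<m))) with a + suc b ≟ m
... | yes refl = contradiction a+b<m (<-irrefl refl)
... | no  _    = here (there (there (here refl)))
star-covers m {suc a} {zero} △₁ _ with a ≟ m
... | yes _ = here (here refl)
... | no  _ = here (here refl)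
star-covers m {suc a} {suc b} △₁ _ with a + suc b ≟ m
... | yes _ = there (here (here refl))
... | no  _ = here (here refl)
star-covers m {zero} {suc b} △₂ _ with b ≟ m
... | yes _ = here (here refl)
... | no  _ = here (here refl)
star-covers m {suc a} {suc b} △₂ _ with a + suc b ≟ m
... | yes _ = here (here refl)
... | no  _ = here (there (here refl))
star-covers m {suc a} {zero} ▽₁ (in-Δ _ _ (+≤+ (s≤s a<m))) with a ≟ m
... | yes refl = contradiction (subst (_≤ a) (cong suc (+-identityʳ a)) a<m) (<-irrefl refl)
... | no  _    = there (here (there (here refl)))
star-covers m {suc a} {suc b} ▽₁ (in-Δ _ _ (+≤+ (s≤s a+b<m))) with a + suc b ≟ m
... | yes refl = contradiction a+b<m (<-irrefl refl)
... | no  _    = here (there (there (there (there (here refl)))))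
star-covers m {zero} {suc b} ▽₂ (in-Δ _ _ (+≤+ (s≤s b<m))) with b ≟ m
... | yes refl = contradiction b<m (<-irrefl refl)
... | no  _    = there (here (there (here refl)))
star-covers m {suc a} {suc b} ▽₂ (in-Δ _ _ (+≤+ (s≤s a+b<m))) with a + suc b ≟ m
... | yes refl = contradiction (subst (_≤ a + suc b) (cong suc (sym (+-suc a b))) a+b<m) (<-irrefl refl)
... | no  _    = here (there (there (there (there (there (here refl))))))
star-covers m {suc a} {suc b} ▽₃ _ with a + suc b ≟ m
... | yes _ = there (here (there (here refl)))
... | no  _ = here (there (there (there (here refl))))

δ-≢ : ∀ {a b} → a ≢ b → δ a b ≡ 0
δ-≢ {zero}  {zero}  a≢b = contradiction refl a≢b
δ-≢ {zero}  {suc b} a≢b = refl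
δ-≢ {suc a} {zero}  a≢b = refl
δ-≢ {suc a} {suc b} a≢b = δ-≢ (a≢b ∘ cong suc)

-- In a corner the star is a lone triangle; any other star has as many triangles as
-- parallelograms.
star-count : ∀ m a b → corner (suc m) a b + #parallelograms (star m a b) ≡ #triangles (star m a b)
star-count m zero    zero = refl
star-count m (suc a) zero with a ≟ m
... | yes refl rewrite δ-refl a = refl
... | no  a≢m  rewrite δ-≢ (a≢m ∘ sym) = refl
star-count m zero (suc b) with b ≟ m
... | yes refl rewrite δ-refl b = refl
... | no  b≢m  rewrite δ-≢ (b≢m ∘ sym) = refl
star-count m (suc a) (suc b) with a + suc b ≟ m | *-zeroʳ (δ m a)
... | yes refl | eq rewrite eq = refl
... | no  _    | eq rewrite eq = refl

-- Of the three vertices of a tile, exactly one is coloured.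
Coloured : ℕ × ℕ → Set
Coloured (a , b) = 3 ∣ a + 2 * b

coloured? : ∀ v → Dec (Coloured v)
coloured? (a , b) = 3 ∣? a + 2 * b

stars : ℕ → ℕ × ℕ → List Cell
stars m v with coloured? v
... | yes _ = uncurry (star m) v
... | no  _ = []

starCells : ℕ → List Cell
starCells m = concatMap (stars m) (pairs (suc (suc m)))

∈stars⁻ : ∀ m {a b C} → C ∈ stars m (a , b) → Coloured (a , b) × C ∈ star m a b
∈stars⁻ m {a} {b} C∈ with coloured? (a , b)
... | yes c = c , C∈

¬3∣-both : ∀ {l} k → ¬ 3 ∣ l → 3 ∣ k → ¬ 3 ∣ l + k
¬3∣-both {l} k 3∤l 3∣k 3∣l+k = 3∤l (∣m+n∣m⇒∣n (subst (3 ∣_) (+-comm l k) 3∣l+k) 3∣k)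

3∤1+ : ∀ k → 3 ∣ k → ¬ 3 ∣ 1 + k
3∤1+ k = ¬3∣-both {1} k (>⇒∤ (s≤s (s≤s z≤n)))

3∤2+ : ∀ k → 3 ∣ k → ¬ 3 ∣ 2 + k
3∤2+ k = ¬3∣-both {2} k (>⇒∤ (s≤s (s≤s (s≤s z≤n))))

colour-suc : ∀ i j → i + 2 * suc j ≡ 2 + (i + 2 * j)
colour-suc = solve 2 (λ i j → i :+ con 2 :* (con 1 :+ j) := con 2 :+ (i :+ con 2 :* j)) refl
  where open +-*-Solver

offset : ∀ {a b τ} → Vertex a b τ → ℕ
offset △₀ = 0
offset △₁ = 1
offset △₂ = 2
offset ▽₁ = 1
offset ▽₂ = 2
offset ▽₃ = 3

base : Tile → ℕ
base τ = ℤ.∣ col τ ∣ + 2 * ℤ.∣ row τ ∣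

coloured⇒3∣ : ∀ {a b τ} (p : Vertex a b τ) → Coloured (a , b) → 3 ∣ offset p + base τ
coloured⇒3∣ △₀ c = c
coloured⇒3∣ △₁ c = c
coloured⇒3∣ (△₂ {i} {j}) c = subst (3 ∣_) (colour-suc i j) c
coloured⇒3∣ ▽₁ c = c
coloured⇒3∣ (▽₂ {i} {j}) c = subst (3 ∣_) (colour-suc i j) c
coloured⇒3∣ (▽₃ {i} {j}) c = subst (3 ∣_) (cong suc (colour-suc i j)) c

-- The offsets of two distinct vertices of a tile differ by 1 or 2, and 3 divides neither.
coloured-unique : ∀ {a b a′ b′ τ} → Vertex a b τ → Vertex a′ b′ τ →
                  Coloured (a , b) → Coloured (a′ , b′) → (a , b) ≡ (a′ , b′)
coloured-unique {τ = τ} p q c c′ = same p q (coloured⇒3∣ p c) (coloured⇒3∣ q c′)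
  where
  k = base τ
  same : ∀ {a b a′ b′} (p : Vertex a b τ) (q : Vertex a′ b′ τ) →
         3 ∣ offset p + k → 3 ∣ offset q + k → (a , b) ≡ (a′ , b′)
  same △₀ △₀ _ _ = refl
  same △₁ △₁ _ _ = refl
  same △₂ △₂ _ _ = refl
  same ▽₁ ▽₁ _ _ = refl
  same ▽₂ ▽₂ _ _ = refl
  same ▽₃ ▽₃ _ _ = refl
  same △₀ △₁ h h′ = contradiction h′ (3∤1+ k h)
  same △₁ △₀ h h′ = contradiction h (3∤1+ k h′)
  same △₀ △₂ h h′ = contradiction h′ (3∤2+ k h)
  same △₂ △₀ h h′ = contradiction h (3∤2+ k h′)
  same △₁ △₂ h h′ = contradiction h′ (3∤1+ (1 + k) h)
  same △₂ △₁ h h′ = contradiction h (3∤1+ (1 + k) h′)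
  same ▽₁ ▽₂ h h′ = contradiction h′ (3∤1+ (1 + k) h)
  same ▽₂ ▽₁ h h′ = contradiction h (3∤1+ (1 + k) h′)
  same ▽₁ ▽₃ h h′ = contradiction h′ (3∤2+ (1 + k) h)
  same ▽₃ ▽₁ h h′ = contradiction h (3∤2+ (1 + k) h′)
  same ▽₂ ▽₃ h h′ = contradiction h′ (3∤1+ (2 + k) h)
  same ▽₃ ▽₂ h h′ = contradiction h (3∤1+ (2 + k) h′)

3∣-some : ∀ k → 3 ∣ k ⊎ 3 ∣ 1 + k ⊎ 3 ∣ 2 + k
3∣-some zero    = inj₁ (3 ∣0)
3∣-some (suc k) with 3∣-some k
... | inj₁ h        = inj₂ (inj₂ (∣m∣n⇒∣m+n ∣-refl h))
... | inj₂ (inj₁ h) = inj₁ h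
... | inj₂ (inj₂ h) = inj₂ (inj₁ h)

coloured-exists : ∀ {n τ} → InΔ n τ → ∃[ a ] ∃[ b ] Vertex a b τ × Coloured (a , b)
coloured-exists {τ = △ (+ i) (+ j)} _ with 3∣-some (i + 2 * j)
... | inj₁ h        = i , j , △₀ , h
... | inj₂ (inj₁ h) = suc i , j , △₁ , h
... | inj₂ (inj₂ h) = i , suc j , △₂ , subst (3 ∣_) (sym (colour-suc i j)) h
coloured-exists {τ = ▽ (+ i) (+ j)} _ with 3∣-some (i + 2 * j)
... | inj₁ h        = suc i , suc j , ▽₃ , subst (3 ∣_) (cong suc (sym (colour-suc i j))) (∣m∣n⇒∣m+n (∣-refl {3}) h)
... | inj₂ (inj₁ h) = suc i , j , ▽₁ , h
... | inj₂ (inj₂ h) = i , suc j , ▽₂ , subst (3 ∣_) (sym (colour-suc i j)) h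

vertex-InΔ : ∀ {n a b τ} → Vertex a b τ → InΔ n τ → a + b ≤ n
vertex-InΔ △₀ (in-Δ _ _ (+≤+ k<n)) = <⇒≤ k<n
vertex-InΔ △₁ (in-Δ _ _ (+≤+ k<n)) = k<n
vertex-InΔ (△₂ {i} {j}) (in-Δ _ _ (+≤+ k<n)) = ≤-trans (≤-reflexive (+-suc i j)) k<n
vertex-InΔ ▽₁ (in-Δ _ _ (+≤+ k<n)) = <⇒≤ k<n
vertex-InΔ (▽₂ {i} {j}) (in-Δ _ _ (+≤+ k<n)) = ≤-trans (≤-reflexive (+-suc i j)) (<⇒≤ k<n)
vertex-InΔ (▽₃ {i} {j}) (in-Δ _ _ (+≤+ k<n)) = ≤-trans (≤-reflexive (cong suc (+-suc i j))) k<n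

∈stars⁺ : ∀ m {a b} {P : Cell → Set} → Coloured (a , b) → Any P (star m a b) → Any P (stars m (a , b))
∈stars⁺ m {a} {b} c p with coloured? (a , b)
... | yes _ = p
... | no ¬c = contradiction c ¬c

starCells-cover : ∀ m {τ} → InΔ (suc m) τ → Any (λ C → τ ∈ tiles C) (starCells m)
starCells-cover m {τ} τ∈Δ with coloured-exists τ∈Δ
... | a , b , p , c = Any.concatMap⁺ (stars m) {xs = pairs (suc (suc m))}
  (lose {P = Any (λ C → τ ∈ tiles C) ∘ stars m} (∈-pairs⁺ (suc (suc m)) {a} {b} (s≤s (vertex-InΔ p τ∈Δ)))
    (∈stars⁺ m {a} {b} c (star-covers m p τ∈Δ)))

Apart : Cell → Cell → Set
Apart C D = Disjoint (tiles C) (tiles D)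

starCells-apart : ∀ m → AllPairs Apart (starCells m)
starCells-apart m = AllPairs.concat⁺ (All.map⁺ {f = stars m} (All.universal within (pairs (suc (suc m)))))
  (AllPairs.map⁺ (AllPairs.map across (pairs-unique (suc (suc m)))))
  where
  within : ∀ v → AllPairs Apart (stars m v)
  within (a , b) with coloured? (a , b)
  ... | yes _ = star-disjoint m a b
  ... | no  _ = []
  across : ∀ {v w} → v ≢ w → All (λ C → All (Apart C) (stars m w)) (stars m v)
  across {a , b} {a′ , b′} v≢w = All.tabulate λ C∈ → All.tabulate λ D∈ (τ∈C , τ∈D) →
    let c , C∈star = ∈stars⁻ m {a} {b} C∈
        c′ , D∈star = ∈stars⁻ m {a′} {b′} D∈
    in v≢w (coloured-unique (All.lookup (All.lookup (star-vertex m a b) C∈star) τ∈C)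
                            (All.lookup (All.lookup (star-vertex m a′ b′) D∈star) τ∈D) c c′)

starCells-inside : ∀ m → All (CellInΔ (suc m)) (starCells m)
starCells-inside m = All.concat⁺ (All.map⁺ {f = stars m} (All.tabulate λ {(a , b)} v∈ → All.tabulate λ C∈ →
  All.lookup (star-inside m a b (≤-pred (∈-pairs⁻ (suc (suc m)) v∈))) (proj₂ (∈stars⁻ m {a} {b} C∈))))

starCells-subdivision : ∀ m → IsSemiuniformSubdivision (suc m) (starCells m)
starCells-subdivision m = record
  { inside   = All.map (λ {C} → CellInΔ-sound {suc m} {C}) (starCells-inside m)
  ; covers   = λ p p∈Δ → let τ , τ∈Δ , p∈τ = Δ-covered m p∈Δ in
      Any.map (λ {C} τ∈C → ⊑-sound {τ} {C} {p} (∈tiles⇒⊑ {τ} {C} τ∈C) p∈τ) (starCells-cover m τ∈Δ)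
  ; disjoint = AllPairs.map (λ {C} {D} apart p (intC , intD) →
      let τ , τ⊑C , τ⊑D = common-tile {C} {D} {p} intC intD in apart (⊑⇒∈tiles τ⊑C , ⊑⇒∈tiles τ⊑D))
      (starCells-apart m)
  }

-- Here `c` marks corners known to be coloured: the origin alone, or all three. It may miss some,
-- whence an inequality; the lower bound later supplies the reverse one.
starCells-count : ∀ m (c : ℕ → ℕ → ℕ) → (∀ i j → c i j ≤ corner (suc m) i j) →
              (∀ i j → ¬ Coloured (i , j) → c i j ≡ 0) →
              ∑△ (suc (suc m)) c + #parallelograms (starCells m) ≤ #triangles (starCells m)
starCells-count m c c≤corner c≡0 = begin
  ∑△ (suc (suc m)) c + #parallelograms (starCells m)
    ≡⟨ cong₂ _+_ (sym (sum-pairs (suc (suc m)) (uncurry c)))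
         (trans (#parallelograms-sum (starCells m)) (sum-concatMap (isPar? ∘ shape) (stars m) vs)) ⟩
  sum (map (uncurry c) vs) + sum (map (sum ∘ map (isPar? ∘ shape) ∘ stars m) vs)
    ≡⟨ sum-map-+ (uncurry c) (sum ∘ map (isPar? ∘ shape) ∘ stars m) vs ⟨
  sum (map (λ v → uncurry c v + sum (map (isPar? ∘ shape) (stars m v))) vs)
    ≤⟨ sum-mono (All.universal bound vs) ⟩
  sum (map (#triangles ∘ stars m) vs)
    ≡⟨ sum-concatMap (isTri ∘ shape) (stars m) vs ⟨
  #triangles (starCells m)
    ∎
  where
  open ≤-Reasoning
  vs = pairs (suc (suc m))
  bound : ∀ v → uncurry c v + sum (map (isPar? ∘ shape) (stars m v)) ≤ #triangles (stars m v)
  bound (a , b) with coloured? (a , b)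
  ... | no ¬c rewrite c≡0 a b ¬c = z≤n
  ... | yes _ = ≤-trans (+-monoˡ-≤ _ (c≤corner a b))
    (≤-reflexive (trans (cong (_+_ (corner (suc m) a b)) (sym (#parallelograms-sum (star m a b)))) (star-count m a b)))

-- The discriminant -7 is 2 modulo 3, a nonresidue. In the last residue class, adding 2 + p gives 4
-- + p (2 + p), which has remainder 1.
3∤p²+p+2 : ∀ p → ¬ 3 ∣ p * p + p + 2
3∤p²+p+2 p h with 3∣-some p
... | inj₁ 3∣p = 3∤2+ (p * p + p) (∣m∣n⇒∣m+n (∣m⇒∣m*n p 3∣p) 3∣p) (subst (3 ∣_) (+-comm (p * p + p) 2) h)
... | inj₂ (inj₁ 3∣1+p) = 3∤2+ (p * p + p) (subst (3 ∣_) (solve 1 (λ p → p :* (con 1 :+ p)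
    := p :* p :+ p) refl p) (∣n⇒∣m*n p 3∣1+p))
  (subst (3 ∣_) (+-comm (p * p + p) 2) h)
  where open +-*-Solver
... | inj₂ (inj₂ 3∣2+p) = 3∤1+ (3 + p * (2 + p)) (∣m∣n⇒∣m+n ∣-refl (∣n⇒∣m*n p 3∣2+p))
  (subst (3 ∣_) (solve 1 (λ p → p :* p :+ p :+ con 2 :+ (con 2 :+ p)
      := con 4 :+ p :* (con 2 :+ p)) refl p) (∣m∣n⇒∣m+n h 3∣2+p))
  where open +-*-Solver

-- Modulo 3, the number p of parallelograms is determined by 2p ≡ (n - 1)n, and the
-- bound n ≤ 3 + p leaves only few candidates.
mod-3-gap : ∀ m p h → suc m ≤ 3 + p → 2 * (p + 3 * h) ≡ m * suc m → ¬ 3 ∣ suc m → m ≤ p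
mod-3-gap m p h (s≤s m≤2+p) eq 3∤n with m≤n⇒m<n∨m≡n m≤2+p
-- The candidate n = p + 3: the count gives 6h = 3 (2 + p) + p², so 3 divides p², hence p, hence n.
... | inj₂ refl = contradiction (∣m∣n⇒∣m+n ∣-refl 3∣p) 3∤n
  where
  open +-*-Solver
  6h≡ : 6 * h ≡ 3 * (2 + p) + p * p
  6h≡ = +-cancelˡ-≡ (2 * p) _ _ (trans
    (solve 2 (λ p h → con 2 :* p :+ con 6 :* h := con 2 :* (p :+ con 3 :* h)) refl p h)
    (trans eq (solve 1 (λ p → (con 2 :+ p) :* (con 3 :+ p)
        := con 2 :* p :+ (con 3 :* (con 2 :+ p) :+ p :* p)) refl p)))
  3∣p : 3 ∣ p
  3∣p = reduce (euclidsLemma p p (from-yes (prime? 3))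
    (∣m+n∣m⇒∣n (subst (3 ∣_) 6h≡ (∣m⇒∣m*n h (divides 2 refl))) (∣m⇒∣m*n (2 + p) ∣-refl)))
... | inj₁ (s≤s m≤1+p) with m≤n⇒m<n∨m≡n m≤1+p
...   | inj₁ (s≤s m≤p) = m≤p
-- The candidate n = p + 2: the count gives 6h = p² + p + 2, never divisible by 3.
...   | inj₂ refl = contradiction (subst (3 ∣_) 6h≡ (∣m⇒∣m*n h (divides 2 refl))) (3∤p²+p+2 p)
  where
  open +-*-Solver
  6h≡ : 6 * h ≡ p * p + p + 2
  6h≡ = +-cancelˡ-≡ (2 * p) _ _ (trans
    (solve 2 (λ p h → con 2 :* p :+ con 6 :* h := con 2 :* (p :+ con 3 :* h)) refl p h)
    (trans eq (solve 1 (λ p → (con 1 :+ p) :* (con 2 :+ p) := con 2 :* p :+ (p :* p :+ p :+ con 2)) refl p)))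

-- The bounds for arbitrary subdivisions and for the stars

module _ (m : ℕ) (cs : List Cell) (S : IsSemiuniformSubdivision (suc m) cs) where
  open Tiling m cs (subdivision⇒tiling S)
  open LowerBound m cs (subdivision⇒tiling S)

  n∸3≤#parallelograms : suc m ∸ 3 ≤ #parallelograms cs
  n∸3≤#parallelograms = m≤n+o⇒m∸n≤o (suc m) 3 n≤3+#parallelograms

  n∸1≤#parallelograms : ¬ 3 ∣ suc m → m ≤ #parallelograms cs
  n∸1≤#parallelograms = mod-3-gap m (#parallelograms cs) (#hexagons cs) n≤3+#parallelograms
    (trans (cong (2 *_) pars+3hexes) (2*∑△-one m))

starCells-#triangles : ∀ m → #triangles (starCells m) ≡ suc m
starCells-#triangles m = Tiling.#triangles≡n m (starCells m) (subdivision⇒tiling (starCells-subdivision m))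

∑△-coloured-≤ : ∀ m (c : ℕ → ℕ → ℕ) k → ∑△ (suc (suc m)) c ≡ k → (∀ i j → c i j ≤ corner (suc m) i j) →
              (∀ i j → ¬ Coloured (i , j) → c i j ≡ 0) → #parallelograms (starCells m) ≤ suc m ∸ k
∑△-coloured-≤ m c k refl c≤corner c≡0 =
  m+n≤o⇒m≤o∸n (#parallelograms (starCells m)) (≤-trans (≤-reflexive (+-comm (#parallelograms (starCells m)) k))
    (≤-trans (starCells-count m c c≤corner c≡0) (≤-reflexive (starCells-#triangles m))))

δ-uncoloured : ∀ {i j} a b → Coloured (a , b) → ¬ Coloured (i , j) → δ a i * δ b j ≡ 0
δ-uncoloured {i} {j} a b c ¬c with a ≟ i | b ≟ j
... | no a≢i   | _        rewrite δ-≢ a≢i = refl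
... | yes _    | no b≢j   rewrite δ-≢ b≢j = *-zeroʳ (δ a i)
... | yes refl | yes refl = contradiction c ¬c

starCells-n∸1 : ∀ m → #parallelograms (starCells m) ≤ m
starCells-n∸1 m = ∑△-coloured-≤ m (λ i j → δ 0 i * δ 0 j) 1 (∑△-δ (suc (suc m)) 0 0 (s≤s z≤n))
  (λ i j → ≤-trans (m≤m+n _ _) (m≤m+n _ _)) (λ i j → δ-uncoloured {i} {j} 0 0 (3 ∣0))

starCells-n∸3 : ∀ m → 3 ∣ suc m → #parallelograms (starCells m) ≤ suc m ∸ 3
starCells-n∸3 m 3∣n = ∑△-coloured-≤ m (corner (suc m)) 3 (∑△-corner (suc m)) (λ _ _ → ≤-refl)
  λ i j ¬c → cong₂ _+_ (cong₂ _+_ (δ-uncoloured {i} {j} 0 0 (3 ∣0) ¬c)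
    (δ-uncoloured {i} {j} (suc m) 0 (subst (3 ∣_) (sym (+-identityʳ (suc m))) 3∣n) ¬c))
    (δ-uncoloured {i} {j} 0 (suc m) (∣n⇒∣m*n 2 3∣n) ¬c)

theorem3p3p1 : (n : ℕ) → .{{_ : NonZero n}} →
    ((cells : List Cell) → IsSemiuniformSubdivision n cells →
    (3 ∣ n → n ∸ 3 ≤ #parallelograms cells) × (¬ (3 ∣ n) → n ∸ 1 ≤ #parallelograms cells))
    × ((3 ∣ n → Σ (List Cell) λ cells → IsSemiuniformSubdivision n cells × (#parallelograms cells ≡ n ∸ 3))
    × (¬ (3 ∣ n) → Σ (List Cell) λ cells → IsSemiuniformSubdivision n cells × (#parallelograms cells ≡ n ∸ 1)))
theorem3p3p1 (suc m) =
  (λ cs S → (λ _ → n∸3≤#parallelograms m cs S) , n∸1≤#parallelograms m cs S) ,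
  (λ 3∣n → starCells m , starCells-subdivision m ,
     ≤-antisym (starCells-n∸3 m 3∣n) (n∸3≤#parallelograms m (starCells m) (starCells-subdivision m))) ,
  (λ 3∤n → starCells m , starCells-subdivision m ,
     ≤-antisym (starCells-n∸1 m) (n∸1≤#parallelograms m (starCells m) (starCells-subdivision m) 3∤n))
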